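{- Let $A$ be a finite set with $|A|\ge 2$ and let $n\ge 2$. Every transformation $f:A^n\to A^n$ can be computed by a program of at most $4n-3$ instructions, i.e. $\mathcal{L}(f)\le 4n-3$.
   Context: A transformation of $A^n$ is a map $f=(f_1,\dots,f_n):A^n\to A^n$; its coordinate function $f_i:A^n\to A$ is trivial if $f_i(x)=x_i$ for all $x$. An instruction is a transformation of $A^n$ with at most one nontrivial coordinate function. A program of length $L$ computing $f$ is a sequence of instructions $g^1,\dots,g^L$ with $f=g^L\circ\cdots\circ g^1$. The procedural complexity $\mathcal{L}(f)$ is the shortest length of a program computing $f$; the identity has procedural complexity $0$. -}

module Defs where

open import Data.Fin.Base using (Fin)
open import Data.Nat.Base using (ℕ; _≤_)
open import Data.Product.Base using (Σ; _×_; _,_)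
open import Data.Vec.Base using (Vec; []; _∷_; lookup)
open import Function.Base using (id; _∘_)
open import Level using (Level)
open import Relation.Binary.PropositionalEquality using (_≡_; _≗_)
open import Relation.Nullary.Negation using (¬_)

private
  variable
    a : Level
    A : Set a
    n L : ℕ

Transformation : Set a → ℕ → Set a
Transformation A n = Vec A n → Vec A n

coordinate : Transformation A n → Fin n → Vec A n → A
coordinate f i x = lookup (f x) i

Trivial : Transformation A n → Fin n → Set _
Trivial f i = ∀ x → coordinate f i x ≡ lookup x i

IsInstruction : Transformation A n → Set _
IsInstruction {n = n} f = ∀ (i j : Fin n) → ¬ Trivial f i → ¬ Trivial f j → i ≡ j

Instruction : Set a → ℕ → Set a
Instruction A n = Σ (Transformation A n) IsInstruction

Program : Set a → ℕ → ℕ → Set a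
Program A n L = Vec (Instruction A n) L

-- The head of the vector is the instruction applied first:
-- ⟦ g¹ ∷ … ∷ gᴸ ∷ [] ⟧ is gᴸ ∘ … ∘ g¹.
⟦_⟧ : Program A n L → Transformation A n
⟦ [] ⟧          = id
⟦ (g , _) ∷ p ⟧ = ⟦ p ⟧ ∘ g

-- Transformations are compared pointwise, as there is no function
-- extensionality.
_Computes_ : Program A n L → Transformation A n → Set _
p Computes f = ⟦ p ⟧ ≗ f

ComputableInLength : Transformation A n → ℕ → Set _
ComputableInLength {A = A} {n = n} f L = Σ (Program A n L) (_Computes f)

-- A relation between f and L, since a total function could only be defined
-- after showing that every transformation is computed by some program.
IsProceduralComplexity : Transformation A n → ℕ → Set _
IsProceduralComplexity f L =
  ComputableInLength f L × (∀ L′ → ComputableInLength f L′ → L ≤ L′)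

{-# OPTIONS --safe #-}
module Submission where

-- Write f = τ ∘ e ∘ π with τ, π permutations and e triangular: the k-th
-- coordinate of e(x) depends on x_k, …, x_n only.  Such a factorisation exists
-- because the q^n fibre sizes, with sum q^n, can be grouped q at a time so that
-- every group has a sum divisible by q (Erdős–Ginzburg–Ziv); f then maps lines to
-- lines up to relabelling source and target, and one recurses on the induced map
-- on lines.  By König's edge-colouring theorem a permutation factors as an
-- instruction on coordinate 1, a family of permutations of the other
-- coordinates, and a second instruction on coordinate 1 (a Beneš network), so it
-- is computed by instructions on the coordinates 1, …, n, …, 1.  A triangular map
-- in front is absorbed by the first half of this network.  Hence π and τ ∘ e cost
-- 2n − 1 instructions each, and the last of π merges with the first of τ ∘ e.
open import Defs
open import Data.Bool.Base using (Bool; true; false; not)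
open import Data.Bool.Properties using (not-¬; not-involutive)
open import Data.Empty using (⊥-elim)
open import Data.Fin.Base using (Fin; zero; suc; toℕ; cast; combine; funToFin; finToFun)
import Data.Fin.Properties as Fin
open import Data.List.Base as List
  using (List; []; _∷_; [_]; length; _++_; concat; map; take; drop; filter; allFin)
open import Data.List.Properties
  using (filter-notAll; length-++; length-map; length-tabulate; length-take; length-drop;
         map-++; concat-++; concat-concat; concat-map-[_]; take++drop≡id)
open import Data.List.Membership.Propositional using (_∈_; _∉_; find; lose)
open import Data.List.Membership.Propositional.Properties
  using (∈-allFin; ∈-map⁺; ∈-map⁻; ∈-filter⁺; ∈-filter⁻; ∈-concat⁺′; ∈-concat⁻; ∈-concat⁻′; ∈-lookup; ∈-∃++)
open import Data.List.Relation.Unary.All as All using (All; []; _∷_)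
import Data.List.Relation.Unary.All.Properties as All
open import Data.List.Relation.Unary.AllPairs using (_∷_)
open import Data.List.Relation.Unary.Any as Any using (Any; here; there)
open import Data.List.Relation.Unary.Any.Properties using (lookup-index)
open import Data.List.Relation.Unary.Unique.Propositional using (Unique)
import Data.List.Relation.Unary.Unique.Propositional.Properties as Unique
open import Data.List.Relation.Binary.Permutation.Propositional as Perm
  using (_↭_; ↭-refl; ↭-sym; ↭-trans; ↭-reflexive; module PermutationReasoning)
open import Data.List.Relation.Binary.Permutation.Propositional.Properties
  using (↭-length; ∈-resp-↭; All-resp-↭; map⁺; ++⁺ˡ; ++⁺ʳ; ++-comm; ++-assoc; ++-identityʳ; shift; shifts)
open import Data.Nat.Base using (ℕ; zero; suc; _≤_; _*_; _∸_; _+_; _^_; _<_; z≤n; s≤s; NonZero; >-nonZero)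
open import Data.Nat.DivMod
  using (_/_; _%_; _mod_; %-distribˡ-+; m%n%n≡m%n; m*n%n≡0; m%n<n; m<n⇒m%n≡m; m/n*n≡m)
open import Data.Nat.Divisibility
  using (_∣_; divides; 1∣_; >⇒∤; ∣-trans; m∣m*n; ∣m+n∣m⇒∣n; m%n≡0⇒n∣m; n∣m⇒m%n≡0; *-cancelʳ-∣; *-monoˡ-∣)
open import Data.Nat.Induction using (<-rec)
open import Data.Nat.ListAction using (sum; product)
open import Data.Nat.ListAction.Properties using (sum-++; sum-↭)
open import Data.Nat.Primality using (Prime; euclidsLemma; prime⇒nonZero)
open import Data.Nat.Primality.Factorisation using (factorise; PrimeFactorisation)
open import Data.Nat.Properties as ℕ hiding (_≟_)
open import Data.Nat.Tactic.RingSolver using (solve-∀)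
open import Data.Product.Base using (Σ; ∃-syntax; _×_; _,_; proj₁; proj₂)
open import Data.Sum.Base using (_⊎_; inj₁; inj₂; [_,_]′)
open import Data.Unit.Base using (⊤; tt)
open import Data.Vec.Base as Vec using (Vec; []; _∷_; lookup; tabulate; head; tail; _[_]≔_)
open import Data.Vec.Properties as Vec
  using (lookup∘tabulate; tabulate∘lookup; lookup∘updateAt′; []≔-idempotent)
open import Function.Base using (_∘_; id)
open import Function.Bundles using (_↔_; Inverse)
open import Function.Construct.Symmetry using (↔-sym)
open import Function.Definitions using (Injective)
open import Level using (Level; 0ℓ)
open import Relation.Binary.Bundles using (Setoid)
open import Relation.Binary.Definitions using (DecidableEquality)
open import Relation.Binary.PropositionalEquality hiding ([_])
import Relation.Binary.Reasoning.Setoid as SetoidReasoning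
open import Relation.Nullary using (¬_; Dec; yes; no; contradiction)
open import Relation.Nullary.Decidable using (map′; ¬?; _×-dec_; _⊎-dec_; _→-dec_)

-- The network routes permutations only: the colouring needs at most q points over each source line
-- and each target line. A general `f` must therefore be reduced to permutations and a middle factor
-- that costs nothing extra. Triangular maps are free because the network visits the coordinates in
-- increasing order on its way in. When coordinate k is first rewritten, coordinates k, ..., n still
-- hold input values, and these determine coordinates k, ..., n of e(x); the earlier coordinates
-- hold the colours already chosen. The group sums of fibre sizes are required to be divisible by q,
-- not equal to q, since one fibre may exceed q points. Divisibility suffices to cut the preimage of
-- a group into blocks of q points; some target lines then receive several source lines and others
-- none. Erdős-Ginzburg-Ziv is proved for primes, and the grouping statement, not the zero-sum
-- theorem, is carried over to products. The conclusion asserts that a least length exists, so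
-- computability in a given length also has to be decided, by a finite search over `Fin q`.

-- König's edge-colouring theorem for bipartite multigraphs

module EdgeColouring {E : Set} (_≟_ : DecidableEquality E) where

  Proper : {C W : Set} → (E → C) → (E → W) → (E → Set) → Set
  Proper c w P = ∀ {x y} → P x → P y → w x ≡ w y → c x ≡ c y → x ≡ y

  Degree≤2 : {W : Set} → (E → W) → (E → Set) → Set
  Degree≤2 w P = ∀ {x y z} → P x → P y → P z → w x ≡ w y → w y ≡ w z →
                 x ≡ y ⊎ y ≡ z ⊎ x ≡ z

  Avoids : {C W : Set} → (E → C) → (E → W) → (E → Set) → E → C → Set
  Avoids c w P e b = ∀ {y} → P y → w y ≡ w e → c y ≢ b

  _[_↦_] : {C : Set} → (E → C) → E → C → E → C
  (c [ e ↦ b ]) x with x ≟ e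
  ... | yes _ = b
  ... | no  _ = c x

  module _ {C W : Set} {c : E → C} {w : E → W} {P : E → Set} {e : E} {b : C} where

    extend-avoids : ∀ {e′ b′} → Avoids c w P e′ b′ → b ≢ b′ →
                    Avoids (c [ e ↦ b ]) w (λ x → x ≡ e ⊎ P x) e′ b′
    extend-avoids av b≢b′ {y} py wy with y ≟ e
    ... | yes _ = b≢b′
    extend-avoids av b≢b′ (inj₁ y≡e) wy | no y≢e = contradiction y≡e y≢e
    extend-avoids av b≢b′ (inj₂ py)  wy | no _   = av py wy

    extend-proper : Proper c w P → Avoids c w P e b →
                    Proper (c [ e ↦ b ]) w (λ x → x ≡ e ⊎ P x)
    extend-proper pr av {x} {y} px py w≡ c≡ with x ≟ e | y ≟ e
    ... | yes x≡e | yes y≡e = trans x≡e (sym y≡e)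
    extend-proper pr av px (inj₁ y≡e) w≡ c≡ | _ | no y≢e = contradiction y≡e y≢e
    extend-proper pr av (inj₁ x≡e) py w≡ c≡ | no x≢e | _ = contradiction x≡e x≢e
    extend-proper pr av px (inj₂ py) w≡ c≡ | yes refl | no _ = contradiction (sym c≡) (av py (sym w≡))
    extend-proper pr av (inj₂ px) py w≡ c≡ | no _ | yes refl = contradiction c≡ (av px w≡)
    extend-proper pr av (inj₂ px) (inj₂ py) w≡ c≡ | no _ | no _ = pr px py w≡ c≡

  restrict : {C W : Set} {c : E → C} {w : E → W} {P Q : E → Set} →
             (∀ {x} → Q x → P x) → Proper c w P → Proper c w Q
  restrict Q⊆P pr qx qy = pr (Q⊆P qx) (Q⊆P qy)

  infixl 6 _∖_
  _∖_ : List E → E → List E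
  es ∖ e = filter (λ x → ¬? (x ≟ e)) es

  ∈-∖⁻ : ∀ {es e x} → x ∈ es ∖ e → x ∈ es × x ≢ e
  ∈-∖⁻ {e = e} = ∈-filter⁻ (λ x → ¬? (x ≟ e))

  ∈-∖-split : ∀ {es e x} → x ∈ es → x ≡ e ⊎ x ∈ es ∖ e
  ∈-∖-split {e = e} {x} x∈ with x ≟ e
  ... | yes x≡e = inj₁ x≡e
  ... | no  x≢e = inj₂ (∈-filter⁺ (λ x → ¬? (x ≟ e)) x∈ x≢e)

  length-∖ : ∀ {es e k} → e ∈ es → length es ≤ suc k → length (es ∖ e) ≤ k
  length-∖ {e = e} e∈ le = ≤-pred (≤-trans
    (filter-notAll (λ x → ¬? (x ≟ e)) _ (Any.map (λ e≡x x≢e → x≢e (sym e≡x)) e∈)) le)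

  choose-one : {W : Set} → DecidableEquality W → ∀ (d : E → Bool) (w : E → W) es e →
    (∀ {x y} → x ∈ es → y ∈ es → w x ≡ w e → w y ≡ w e → x ≡ y) →
    ∃[ b ] Avoids d w (_∈ es) e b
  choose-one _≟ᵂ_ d w es e uniq with Any.any? (λ x → w x ≟ᵂ w e) es
  ... | no ¬s = true , λ y∈ eq → ⊥-elim (¬s (lose y∈ eq))
  ... | yes s with find s
  ...   | g , g∈ , wg = not (d g) ,
          λ y∈ eq dy → not-¬ (cong d (sym (uniq g∈ y∈ wg eq))) dy

  -- An edge already present at either end forces the choice. If there is one at each end, `cross`
  -- says that they have opposite colours, so the two forced choices agree.
  choose : {W : Set} → DecidableEquality W → ∀ (d : E → Bool) (w : E → W) es e e′ →
    (∀ {x y} → x ∈ es → y ∈ es → w x ≡ w e → w y ≡ w e → x ≡ y) →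
    (∀ {x y} → x ∈ es → y ∈ es → w x ≡ w e′ → w y ≡ w e′ → x ≡ y) →
    (∀ {x y} → x ∈ es → y ∈ es → w x ≡ w e → w y ≡ w e′ → d x ≢ d y) →
    ∃[ b ] Avoids d w (_∈ es) e b × Avoids d w (_∈ es) e′ (not b)
  choose _≟ᵂ_ d w es e e′ uniq uniq′ cross
    with Any.any? (λ x → w x ≟ᵂ w e) es | Any.any? (λ x → w x ≟ᵂ w e′) es
  ... | yes s | _ with find s
  ...   | g , g∈ , wg = not (d g)
          , (λ y∈ eq dy → not-¬ (cong d (sym (uniq g∈ y∈ wg eq))) dy)
          , (λ y∈ eq dy → cross g∈ y∈ wg eq (trans (sym (not-involutive (d g))) (sym dy)))
  choose _≟ᵂ_ d w es e e′ uniq uniq′ cross | no ¬s | yes s′ with find s′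
  ...   | g , g∈ , wg = d g , (λ y∈ eq → ⊥-elim (¬s (lose y∈ eq)))
          , (λ y∈ eq dy → not-¬ (cong d (sym (uniq′ g∈ y∈ wg eq))) dy)
  choose _≟ᵂ_ d w es e e′ uniq uniq′ cross | no ¬s | no ¬s′ =
    true , (λ y∈ eq → ⊥-elim (¬s (lose y∈ eq))) , (λ y∈ eq → ⊥-elim (¬s′ (lose y∈ eq)))

  -- Two edges e, e′ at a common end get opposite colours, so their other ends
  -- may be merged and both edges deleted; a proper colouring of the smaller
  -- graph leaves a consistent choice for e and e′.
  two-colouring : {U V : Set} → DecidableEquality V → DecidableEquality U →
    ∀ k es → length es ≤ k → (u : E → U) (v : E → V) →
    Degree≤2 u (_∈ es) → Degree≤2 v (_∈ es) →
    ∃[ d ] Proper {Bool} d u (_∈ es) × Proper d v (_∈ es)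
  two-colouring _ _ k [] _ u v _ _ = (λ _ → true) , (λ ()) , (λ ())
  two-colouring {U} {V} _≟ⱽ_ _≟ᵁ_ (suc k) es@(e ∷ _) le u v du dv
    with Any.any? (λ x → u x ≟ᵁ u e) (es ∖ e)
  -- No other edge shares the `u`-end of `e`, so only the `v`-end constrains its colour.
  ... | no none =
        d [ e ↦ b ] , restrict ∈-∖-split (extend-proper (proj₁ prd) (λ y∈ eq → ⊥-elim (none (lose y∈ eq))))
                    , restrict ∈-∖-split (extend-proper (proj₂ prd) b-av)
    where
    sub : ∀ {x} → x ∈ es ∖ e → x ∈ es
    sub = proj₁ ∘ ∈-∖⁻
    ne : ∀ {x} → x ∈ es ∖ e → x ≢ e
    ne {x} = proj₂ ∘ ∈-∖⁻ {es}
    rec = two-colouring _≟ⱽ_ _≟ᵁ_ k (es ∖ e) (length-∖ {es} (here refl) le) u v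
            (λ p q r → du (sub p) (sub q) (sub r)) (λ p q r → dv (sub p) (sub q) (sub r))
    d = proj₁ rec
    prd = proj₂ rec
    uniq : ∀ {x y} → x ∈ es ∖ e → y ∈ es ∖ e → v x ≡ v e → v y ≡ v e → x ≡ y
    uniq x∈ y∈ p q = [ id , [ (λ r → ⊥-elim (ne y∈ r)) , (λ r → ⊥-elim (ne x∈ r)) ]′ ]′
      (dv (sub x∈) (sub y∈) (here refl) (trans p (sym q)) q)
    choice = choose-one _≟ⱽ_ d v (es ∖ e) e uniq
    b = proj₁ choice
    b-av = λ {y} → proj₂ choice {y}
  ... | yes some with find some
  ...   | e′ , e′∈ , ue′ =
        d [ e ↦ b ] [ e′ ↦ not b ]
        , restrict split (extend-proper (extend-proper (proj₁ prd) (λ p q _ → u-av p q))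
                           (extend-avoids {P = _∈ es₂} {e = e} (λ p q _ → u-av p (trans q ue′)) (not-¬ refl)))
        , restrict split (extend-proper (extend-proper
                              (λ p q eq → proj₂ prd p q (cong merge eq)) b-av)
                           (extend-avoids {P = _∈ es₂} {e = e} b-av′ (not-¬ refl)))
    where
    es₂ : List E
    es₂ = es ∖ e ∖ e′
    sub : ∀ {x} → x ∈ es₂ → x ∈ es
    sub = proj₁ ∘ ∈-∖⁻ ∘ proj₁ ∘ ∈-∖⁻ {es ∖ e}
    ne : ∀ {x} → x ∈ es₂ → x ≢ e
    ne = proj₂ ∘ ∈-∖⁻ {es} ∘ proj₁ ∘ ∈-∖⁻ {es ∖ e}
    ne′ : ∀ {x} → x ∈ es₂ → x ≢ e′
    ne′ = proj₂ ∘ ∈-∖⁻ {es ∖ e}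
    e∈es : e ∈ es
    e∈es = here refl
    e′∈es : e′ ∈ es
    e′∈es = proj₁ (∈-∖⁻ e′∈)
    e≢e′ : e ≢ e′
    e≢e′ e≡e′ = proj₂ (∈-∖⁻ {es} e′∈) (sym e≡e′)
    split : ∀ {x} → x ∈ es → x ≡ e′ ⊎ x ≡ e ⊎ x ∈ es₂
    split x∈ with ∈-∖-split {e = e} x∈
    ... | inj₁ x≡e = inj₂ (inj₁ x≡e)
    ... | inj₂ x∈′ with ∈-∖-split {e = e′} x∈′
    ...   | inj₁ x≡e′ = inj₁ x≡e′
    ...   | inj₂ x∈″  = inj₂ (inj₂ x∈″)
    merge : V → V
    merge t with t ≟ⱽ v e′
    ... | yes _ = v e
    ... | no  _ = t
    merge-e′ : merge (v e′) ≡ v e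
    merge-e′ with v e′ ≟ⱽ v e′
    ... | yes _ = refl
    ... | no ¬p = contradiction refl ¬p
    merge-e : merge (v e) ≡ v e
    merge-e with v e ≟ⱽ v e′
    ... | yes _ = refl
    ... | no _  = refl
    u-av : ∀ {y} → y ∈ es₂ → u y ≢ u e
    u-av y∈ eq = [ ne y∈ , [ e≢e′ , ne′ y∈ ]′ ]′ (du (sub y∈) e∈es e′∈es eq (sym ue′))
    uniq : ∀ {x y} → x ∈ es₂ → y ∈ es₂ → v x ≡ v e → v y ≡ v e → x ≡ y
    uniq x∈ y∈ p q = [ id , [ (λ r → ⊥-elim (ne y∈ r)) , (λ r → ⊥-elim (ne x∈ r)) ]′ ]′
      (dv (sub x∈) (sub y∈) e∈es (trans p (sym q)) q)
    uniq′ : ∀ {x y} → x ∈ es₂ → y ∈ es₂ → v x ≡ v e′ → v y ≡ v e′ → x ≡ y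
    uniq′ x∈ y∈ p q = [ id , [ (λ r → ⊥-elim (ne′ y∈ r)) , (λ r → ⊥-elim (ne′ x∈ r)) ]′ ]′
      (dv (sub x∈) (sub y∈) e′∈es (trans p (sym q)) q)
    unmerge : ∀ s t → merge s ≡ merge t → s ≡ t ⊎ (s ≡ v e′ × t ≡ v e) ⊎ (s ≡ v e × t ≡ v e′)
    unmerge s t eq with s ≟ⱽ v e′ | t ≟ⱽ v e′
    ... | yes p | yes q = inj₁ (trans p (sym q))
    ... | yes p | no  _ = inj₂ (inj₁ (p , sym eq))
    ... | no  _ | yes q = inj₂ (inj₂ (eq , q))
    ... | no  _ | no  _ = inj₁ eq
    -- With `e` and `e′` deleted, each of `v e` and `v e′` keeps at most one edge, so the merged
    -- vertex has at most two.
    dv₂ : Degree≤2 (merge ∘ v) (_∈ es₂)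
    dv₂ {x} {y} {z} x∈ y∈ z∈ p q with unmerge _ _ p | unmerge _ _ q
    ... | inj₁ p′ | inj₁ q′ = dv (sub x∈) (sub y∈) (sub z∈) p′ q′
    ... | inj₁ p′ | inj₂ (inj₁ (s , _)) = inj₁ (uniq′ x∈ y∈ (trans p′ s) s)
    ... | inj₁ p′ | inj₂ (inj₂ (s , _)) = inj₁ (uniq x∈ y∈ (trans p′ s) s)
    ... | inj₂ (inj₁ (_ , s)) | inj₁ q′ = inj₂ (inj₁ (uniq y∈ z∈ s (trans (sym q′) s)))
    ... | inj₂ (inj₂ (_ , s)) | inj₁ q′ = inj₂ (inj₁ (uniq′ y∈ z∈ s (trans (sym q′) s)))
    ... | inj₂ (inj₁ (r , _)) | inj₂ (inj₂ (_ , s)) = inj₂ (inj₂ (uniq′ x∈ z∈ r s))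
    ... | inj₂ (inj₂ (r , _)) | inj₂ (inj₁ (_ , s)) = inj₂ (inj₂ (uniq x∈ z∈ r s))
    ... | inj₂ (inj₁ (r , s)) | inj₂ (inj₁ (r′ , s′)) = inj₁ (uniq′ x∈ y∈ r r′)
    ... | inj₂ (inj₂ (r , s)) | inj₂ (inj₂ (r′ , s′)) = inj₁ (uniq x∈ y∈ r r′)
    rec = two-colouring _≟ⱽ_ _≟ᵁ_ k es₂
            (length-∖₂ le) u (merge ∘ v)
            (λ p q r → du (sub p) (sub q) (sub r)) dv₂
      where
      length-∖₂ : length es ≤ suc k → length es₂ ≤ k
      length-∖₂ le = ≤-trans (ℕ.<⇒≤ (filter-notAll (λ x → ¬? (x ≟ e′)) (es ∖ e)
        (Any.map (λ e≡x x≢e → x≢e (sym e≡x)) e′∈))) (length-∖ {es} (here refl) le)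
    d = proj₁ rec
    prd = proj₂ rec
    cross : ∀ {x y} → x ∈ es₂ → y ∈ es₂ → v x ≡ v e → v y ≡ v e′ → d x ≢ d y
    cross x∈ y∈ p q dx with proj₂ prd x∈ y∈ (trans (cong merge p) (trans merge-e
                              (sym (trans (cong merge q) merge-e′)))) dx
    -- Equal colours at the merged vertex make `x` and `y` one edge; then `v e` and `v e′` coincide
    -- and `e`, `e′`, `y` are three edges at one vertex.
    ... | refl = [ e≢e′ , [ (λ r → ne′ y∈ (sym r)) , (λ r → ne y∈ (sym r)) ]′ ]′
        (dv e∈es e′∈es (sub y∈) (trans (sym p) q) (sym q))
    choice = choose _≟ⱽ_ d v es₂ e e′ uniq uniq′ cross
    b = proj₁ choice
    b-av = λ {y} → proj₁ (proj₂ choice) {y}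
    b-av′ = λ {y} → proj₂ (proj₂ choice) {y}

  module _ {U V : Set} (_≟ᵁ_ : DecidableEquality U) (_≟ⱽ_ : DecidableEquality V)
           (u : E → U) (v : E → V) where

    Degree≤ : {W : Set} → ℕ → (E → W) → Set
    Degree≤ q w = ∀ (g : Fin (suc q) → E) → Injective _≡_ _≡_ g → ¬ (∀ i → w (g i) ≡ w (g zero))

    -- If every colour occurred at this end, one edge of each colour together with `e` would be
    -- `suc q` distinct edges there.
    free-colour : {W : Set} → DecidableEquality W → ∀ {q} (w : E → W) → Degree≤ q w →
      ∀ (c : E → Fin q) es e → ¬ e ∈ es → ∃[ a ] Avoids c w (_∈ es) e a
    free-colour _≟ᵂ_ {q} w deg c es e e∉
      with Fin.any? (λ a → ¬? (Any.any? (λ y → (w y ≟ᵂ w e) ×-dec (c y Fin.≟ a)) es))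
    ... | yes (a , ¬s) = a , λ y∈ wy cy → ¬s (lose y∈ (wy , cy))
    ... | no ¬a = ⊥-elim (deg g g-inj g-const)
      where
      edge : ∀ a → ∃[ y ] y ∈ es × w y ≡ w e × c y ≡ a
      edge a with Any.any? (λ y → (w y ≟ᵂ w e) ×-dec (c y Fin.≟ a)) es
      ... | yes s = find s
      ... | no ¬s = ⊥-elim (¬a (a , ¬s))
      g : Fin (suc q) → E
      g zero = e
      g (suc a) = proj₁ (edge a)
      g-inj : Injective _≡_ _≡_ g
      g-inj {zero} {zero} _ = refl
      g-inj {zero} {suc b} eq = ⊥-elim (e∉ (subst (_∈ es) (sym eq) (proj₁ (proj₂ (edge b)))))
      g-inj {suc a} {zero} eq = ⊥-elim (e∉ (subst (_∈ es) eq (proj₁ (proj₂ (edge a)))))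
      g-inj {suc a} {suc b} eq = cong suc (trans (sym (proj₂ (proj₂ (proj₂ (edge a)))))
        (trans (cong c eq) (proj₂ (proj₂ (proj₂ (edge b))))))
      g-const : ∀ i → w (g i) ≡ w e
      g-const zero = refl
      g-const (suc a) = proj₁ (proj₂ (proj₂ (edge a)))

    -- The colours a and b missing at the two ends of the new edge e: the edges
    -- coloured a or b together with e have maximal degree 2, so they can be
    -- recoloured with a and b alone.
    module Recolour {q} (c : E → Fin q) (es : List E) (e : E) (a b : Fin q)
                    (e∉ : ¬ e ∈ es) (a≢b : a ≢ b) where

      AB? : ∀ x → Dec (c x ≡ a ⊎ c x ≡ b)
      AB? x = (c x Fin.≟ a) ⊎-dec (c x Fin.≟ b)

      ab : List E
      ab = e ∷ filter AB? es

      -- At a vertex each of the two colours occurs at most once. At the end of `e` the colour `f`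
      -- is missing, which leaves room for `e` itself.
      degree≤2 : {W : Set} (w : E → W) {f : Fin q} → (∀ {x} → c x ≡ a ⊎ c x ≡ b → c x ≢ f → ∀ {y} →
                 c y ≡ a ⊎ c y ≡ b → c y ≢ f → c x ≡ c y) →
                 Proper c w (_∈ es) → Avoids c w (_∈ es) e f → Degree≤2 w (_∈ ab)
      degree≤2 w {f} other pr av = deg
        where
        mem : ∀ {x} → x ∈ filter AB? es → x ∈ es × (c x ≡ a ⊎ c x ≡ b)
        mem = ∈-filter⁻ AB?
        same : ∀ {x y} → x ∈ filter AB? es → y ∈ filter AB? es → w x ≡ w e → w y ≡ w e → x ≡ y
        same x∈ y∈ p q with mem x∈ | mem y∈
        ... | x∈′ , cx | y∈′ , cy = pr x∈′ y∈′ (trans p (sym q)) (other cx (av x∈′ p) cy (av y∈′ q))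
        three : ∀ {x y z} → x ∈ filter AB? es → y ∈ filter AB? es → z ∈ filter AB? es →
                w x ≡ w y → w y ≡ w z → x ≡ y ⊎ y ≡ z ⊎ x ≡ z
        three x∈ y∈ z∈ p q with mem x∈ | mem y∈ | mem z∈
        ... | x∈′ , inj₁ cx | y∈′ , inj₁ cy | _ = inj₁ (pr x∈′ y∈′ p (trans cx (sym cy)))
        ... | x∈′ , inj₂ cx | y∈′ , inj₂ cy | _ = inj₁ (pr x∈′ y∈′ p (trans cx (sym cy)))
        ... | x∈′ , inj₁ cx | _ | z∈′ , inj₁ cz = inj₂ (inj₂ (pr x∈′ z∈′ (trans p q) (trans cx (sym cz))))
        ... | x∈′ , inj₂ cx | _ | z∈′ , inj₂ cz = inj₂ (inj₂ (pr x∈′ z∈′ (trans p q) (trans cx (sym cz))))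
        ... | _ | y∈′ , inj₁ cy | z∈′ , inj₁ cz = inj₂ (inj₁ (pr y∈′ z∈′ q (trans cy (sym cz))))
        ... | _ | y∈′ , inj₂ cy | z∈′ , inj₂ cz = inj₂ (inj₁ (pr y∈′ z∈′ q (trans cy (sym cz))))
        deg : Degree≤2 w (_∈ ab)
        deg (here refl) (here refl) _ _ _ = inj₁ refl
        deg (here refl) _ (here refl) _ _ = inj₂ (inj₂ refl)
        deg _ (here refl) (here refl) _ _ = inj₂ (inj₁ refl)
        deg (here refl) (there y∈) (there z∈) p q = inj₂ (inj₁ (same y∈ z∈ (sym p) (trans (sym q) (sym p))))
        deg (there x∈) (here refl) (there z∈) p q = inj₂ (inj₂ (same x∈ z∈ p (sym q)))
        deg (there x∈) (there y∈) (here refl) p q = inj₁ (same x∈ y∈ (trans p q) q)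
        deg (there x∈) (there y∈) (there z∈) p q = three x∈ y∈ z∈ p q

      pick : Bool → Fin q
      pick true  = a
      pick false = b

      pick-injective : ∀ {s t} → pick s ≡ pick t → s ≡ t
      pick-injective {true}  {true}  _ = refl
      pick-injective {false} {false} _ = refl
      pick-injective {true}  {false} p = contradiction p a≢b
      pick-injective {false} {true}  p = contradiction (sym p) a≢b

      pick-ab : ∀ s → pick s ≡ a ⊎ pick s ≡ b
      pick-ab true  = inj₁ refl
      pick-ab false = inj₂ refl

      recolour : (E → Bool) → E → Fin q
      recolour d x with (x ≟ e) ⊎-dec AB? x
      ... | yes _ = pick (d x)
      ... | no  _ = c x

      -- Recoloured edges have colours among `a` and `b`, and untouched ones have neither, so
      -- conflicts can arise only within one of the two classes.
      recolour-proper : {W : Set} {d : E → Bool} {w : E → W} → Proper c w (_∈ es) →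
                        Proper d w (_∈ ab) → Proper (recolour d) w (_∈ e ∷ es)
      recolour-proper {d = d} prc prd {x} {y} x∈ y∈ w≡ c≡
        with (x ≟ e) ⊎-dec AB? x | (y ≟ e) ⊎-dec AB? y
      ... | yes p | yes r = prd (mem x∈ p) (mem y∈ r) w≡ (pick-injective c≡)
        where
        mem : ∀ {x} → x ∈ e ∷ es → x ≡ e ⊎ c x ≡ a ⊎ c x ≡ b → x ∈ ab
        mem _ (inj₁ x≡e) = here x≡e
        mem (here x≡e) (inj₂ cx) = here x≡e
        mem (there x∈) (inj₂ cx) = there (∈-filter⁺ AB? x∈ cx)
      ... | yes _ | no ¬r = ⊥-elim (¬r (inj₂ (subst (λ t → t ≡ a ⊎ t ≡ b) c≡ (pick-ab (d x)))))
      ... | no ¬p | yes _ = ⊥-elim (¬p (inj₂ (subst (λ t → t ≡ a ⊎ t ≡ b) (sym c≡) (pick-ab (d y)))))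
      ... | no ¬p | no ¬r with x∈ | y∈
      ...   | here x≡e | _ = contradiction (inj₁ x≡e) ¬p
      ...   | _ | here y≡e = contradiction (inj₁ y≡e) ¬r
      ...   | there x∈′ | there y∈′ = prc x∈′ y∈′ w≡ c≡

    edge-colouring : ∀ {q} → Degree≤ q u → Degree≤ q v → ∀ {c₀ : E → Fin q} es →
      ∃[ c ] Proper {Fin q} c u (_∈ es) × Proper c v (_∈ es)
    -- `c₀` supplies a colouring when there are no edges; for `q` equal to 0 a map into `Fin q`
    -- could not be produced otherwise.
    edge-colouring du dv {c₀} [] = c₀ , (λ ()) , (λ ())
    edge-colouring {q} du dv {c₀} (e ∷ es) with edge-colouring du dv {c₀} es | Any.any? (e ≟_) es
    ... | c , pu , pv | yes e∈ = c , restrict back pu , restrict back pv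
      where
      back : ∀ {x} → x ∈ e ∷ es → x ∈ es
      back (here refl) = e∈
      back (there x∈)  = x∈
    ... | c , pu , pv | no e∉
      with free-colour _≟ᵁ_ u du c es e e∉ | free-colour _≟ⱽ_ v dv c es e e∉
    ...   | a , ua | b , vb with a Fin.≟ b
    ...     | yes refl = c [ e ↦ a ] , restrict split (extend-proper pu ua)
                                     , restrict split (extend-proper pv vb)
      where
      split : ∀ {x} → x ∈ e ∷ es → x ≡ e ⊎ x ∈ es
      split (here p)  = inj₁ p
      split (there p) = inj₂ p
    ...     | no a≢b = recolour d , recolour-proper pu (proj₁ prd) , recolour-proper pv (proj₂ prd)
      where
      open Recolour c es e a b e∉ a≢b
      only-b : ∀ {x} → c x ≡ a ⊎ c x ≡ b → c x ≢ a → c x ≡ b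
      only-b (inj₁ p) ¬p = contradiction p ¬p
      only-b (inj₂ p) _  = p
      only-a : ∀ {x} → c x ≡ a ⊎ c x ≡ b → c x ≢ b → c x ≡ a
      only-a (inj₁ p) _  = p
      only-a (inj₂ p) ¬p = contradiction p ¬p
      two = two-colouring _≟ⱽ_ _≟ᵁ_ (length ab) ab ≤-refl u v
        (degree≤2 u (λ p p′ r r′ → trans (only-b p p′) (sym (only-b r r′))) pu ua)
        (degree≤2 v (λ p p′ r r′ → trans (only-a p p′) (sym (only-a r r′))) pv vb)
      d = proj₁ two
      prd = proj₂ two

-- Numbering of vectors, and inverses of injective transformations

private variable
  q n : ℕ

Inj : {X Y : Set} → (X → Y) → Set
Inj = Injective _≡_ _≡_

funToFin-cong : ∀ {m k} {f g : Fin m → Fin k} → f ≗ g → funToFin f ≡ funToFin g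
funToFin-cong {zero}  f≗g = refl
funToFin-cong {suc m} f≗g = cong₂ combine (f≗g zero) (funToFin-cong (f≗g ∘ suc))

encode : Vec (Fin q) n → Fin (q ^ n)
encode = funToFin ∘ lookup

decode : ∀ q n → Fin (q ^ n) → Vec (Fin q) n
decode q n = tabulate ∘ finToFun

decode-encode : (x : Vec (Fin q) n) → decode q n (encode x) ≡ x
decode-encode x = trans (Vec.tabulate-cong (Fin.finToFun-funToFin (lookup x))) (tabulate∘lookup x)

encode-decode : ∀ q n (k : Fin (q ^ n)) → encode (decode q n k) ≡ k
encode-decode q n k = trans (funToFin-cong (lookup∘tabulate (finToFun {q} {n} k)))
                                (Fin.funToFin-finToFin {n} {q} k)

decode-injective : Inj (decode q n)
decode-injective {q} {n} {x = k} {l} eq =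
  trans (sym (encode-decode q n k)) (trans (cong encode eq) (encode-decode q n l))

encode-injective : Inj (encode {q} {n})
encode-injective {x = x} {y} eq =
  trans (sym (decode-encode x)) (trans (cong (decode _ _) eq) (decode-encode y))

allVecs : ∀ q n → List (Vec (Fin q) n)
allVecs q n = List.map (decode q n) (allFin (q ^ n))

∈-allVecs : (x : Vec (Fin q) n) → x ∈ allVecs q n
∈-allVecs x = subst (_∈ _) (decode-encode x) (∈-map⁺ (decode _ _) (∈-allFin (encode x)))

injective⇒surjective : ∀ {m} {g : Fin m → Fin m} → Inj g → ∀ y → ∃[ x ] g x ≡ y
injective⇒surjective {m} {g} g-inj y with Fin.any? (λ x → g x Fin.≟ y)
... | yes hit = hit
... | no miss = contradiction (Fin.injective⇒≤ g⁺-inj) 1+n≰n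
  where
  g⁺ : Fin (suc m) → Fin m
  g⁺ zero    = y
  g⁺ (suc x) = g x
  g⁺-inj : Inj g⁺
  g⁺-inj {zero}  {zero}  _  = refl
  g⁺-inj {zero}  {suc x} eq = contradiction (x , sym eq) miss
  g⁺-inj {suc x} {zero}  eq = contradiction (x , eq) miss
  g⁺-inj {suc x} {suc z} eq = cong suc (g-inj eq)

module InjectiveEndo {q n} (g : Transformation (Fin q) n) (g-inj : Inj g) where

  private
    pre : ∀ (y : Vec (Fin q) n) → ∃[ k ] encode (g (decode q n k)) ≡ encode y
    pre y = injective⇒surjective (decode-injective {q} {n} ∘ g-inj ∘ encode-injective) (encode y)

  inv : Transformation (Fin q) n
  inv = decode q n ∘ proj₁ ∘ pre

  inverseˡ : ∀ y → g (inv y) ≡ y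
  inverseˡ y = encode-injective (proj₂ (pre y))

  inverseʳ : ∀ x → inv (g x) ≡ x
  inverseʳ x = g-inj (inverseˡ (g x))

  inv-injective : Inj inv
  inv-injective {x} {y} eq = trans (sym (inverseˡ x)) (trans (cong g eq) (inverseˡ y))

head∷tail : {A : Set} (x : Vec A (suc n)) → head x ∷ tail x ≡ x
head∷tail (a ∷ u) = refl

-- Programs that update coordinates in a prescribed order

module _ {A : Set} where

  set : Fin n → (Vec A n → A) → Transformation A n
  set i h x = x [ i ]≔ h x

  -- The word fixes the coordinates and leaves the update functions free. This is what allows
  -- different maps to share one word and adjacent updates of one coordinate to be fused.
  Follows : List (Fin n) → Transformation A n → Set
  Follows []      f = f ≗ id
  Follows (i ∷ w) f = Σ (Vec _ _ → _) λ h → Σ (Transformation _ _) λ g →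
                      Follows w g × f ≗ g ∘ set i h

  follows-resp : ∀ (w : List (Fin n)) {f g} → f ≗ g → Follows w g → Follows w f
  follows-resp []      f≗g g≗id             x = trans (f≗g x) (g≗id x)
  follows-resp (i ∷ w) f≗g (h , g′ , F , e) = h , g′ , F , λ x → trans (f≗g x) (e x)

  follows-++ : ∀ (w : List (Fin n)) {w′ f g} → Follows w f → Follows w′ g → Follows (w ++ w′) (g ∘ f)
  follows-++ []      {w′} {g = g} f≗id G = follows-resp w′ (λ x → cong g (f≗id x)) G
  follows-++ (i ∷ w) {g = g} (h , f′ , F , e) G = h , g ∘ f′ , follows-++ w F G , λ x → cong g (e x)

  -- The second update of coordinate `i` overwrites the first, so one update suffices that computes
  -- the first value internally.
  follows-merge : ∀ (w : List (Fin n)) {i w′ f g} → Follows (w ++ i ∷ []) f → Follows (i ∷ w′) g →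
                  Follows (w ++ i ∷ w′) (g ∘ f)
  follows-merge [] {i} {g = g} (h , f′ , f′≗id , e) (h′ , g′ , G , e′) =
    h′ ∘ set i h , g′ , G , λ x → begin
      g _                        ≡⟨ cong g (trans (e x) (f′≗id _)) ⟩
      g (set i h x)              ≡⟨ e′ _ ⟩
      g′ (set i h′ (set i h x))  ≡⟨ cong g′ ([]≔-idempotent x i) ⟩
      g′ (set i (h′ ∘ set i h) x) ∎
    where open ≡-Reasoning
  follows-merge (j ∷ w) {g = g} (h , f′ , F , e) G =
    h , g ∘ f′ , follows-merge w F G , λ x → cong g (e x)

  layers : (A → Transformation A n) → Transformation A (suc n)
  layers F (a ∷ u) = a ∷ F a u

  -- All layers use the same word, so they run in parallel: each update reads the unchanged first
  -- coordinate to learn which layer it is in.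
  follows-layers : ∀ (w : List (Fin n)) {F : A → Transformation A n} →
                   (∀ a → Follows w (F a)) → Follows (List.map suc w) (layers F)
  follows-layers []      F≗id (a ∷ u) = cong (a ∷_) (F≗id a u)
  follows-layers (i ∷ w) Fs =
    (λ x → proj₁ (Fs (head x)) (tail x)) ,
    layers (λ a → proj₁ (proj₂ (Fs a))) ,
    follows-layers w (λ a → proj₁ (proj₂ (proj₂ (Fs a)))) ,
    λ { (a ∷ u) → cong (a ∷_) (proj₂ (proj₂ (proj₂ (Fs a))) u) }

  follows-set : ∀ i (h : Vec A n → A) → Follows (i ∷ []) (set i h)
  follows-set i h = h , id , (λ _ → refl) , (λ _ → refl)

  set-isInstruction : ∀ (i : Fin n) h → IsInstruction (set i h)
  set-isInstruction i h j k ¬tj ¬tk = trans (only j ¬tj) (sym (only k ¬tk))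
    where
    only : ∀ j → ¬ Trivial (set i h) j → j ≡ i
    only j ¬t with j Fin.≟ i
    ... | yes j≡i = j≡i
    ... | no  j≢i = contradiction (λ x → lookup∘updateAt′ j i j≢i x) ¬t

  follows⇒computable : ∀ (w : List (Fin n)) {f} → Follows w f → ComputableInLength f (length w)
  follows⇒computable []      f≗id = [] , λ x → sym (f≗id x)
  follows⇒computable (i ∷ w) (h , g , G , e) with follows⇒computable w G
  ... | p , p≗g = (set i h , set-isInstruction i h) ∷ p , λ x → trans (p≗g _) (sym (e x))

-- Routing a permutation through a Beneš network

-- The coordinates 1, …, n, …, 1 of a Beneš network, for n = m + 1.
benes : ∀ m → List (Fin (suc m))
benes zero    = zero ∷ []
benes (suc m) = zero ∷ List.map suc (benes m) ++ zero ∷ []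

Triangular : ∀ {n} → Transformation (Fin q) n → Set
Triangular {n = zero}  e = ⊤
Triangular {n = suc n} e = ∃[ e′ ] Triangular {n = n} e′ × ∀ x → tail (e x) ≡ e′ (tail x)

-- Lines parallel to the first axis are the vertices, once as sources and once as targets. A point
-- `x` is the edge from its own line to the line of `σ x`, so all degrees are at most `q`.
module Layered {q m} (σ : Transformation (Fin q) (suc m)) (σ-inj : Inj σ) where

  open EdgeColouring (Vec.≡-dec {n = suc m} (Fin._≟_ {q}))

  degree : (τ : Transformation (Fin q) (suc m)) → Inj τ →
           Degree≤ (Vec.≡-dec Fin._≟_) (Vec.≡-dec Fin._≟_) tail tail q (tail ∘ τ)
  degree τ τ-inj g g-inj const with Fin.pigeonhole (n<1+n q) (head ∘ τ ∘ g)
  ... | i , j , i<j , eq = Fin.<⇒≢ i<j (g-inj (τ-inj (begin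
      τ (g i)                         ≡⟨ head∷tail _ ⟨
      head (τ (g i)) ∷ tail (τ (g i)) ≡⟨ cong₂ _∷_ eq (trans (const i) (sym (const j))) ⟩
      head (τ (g j)) ∷ tail (τ (g j)) ≡⟨ head∷tail _ ⟩
      τ (g j)                         ∎)))
    where open ≡-Reasoning

  private
    -- Every point is an edge; `head` is passed as the colouring for the empty edge list.
    coloured = edge-colouring (Vec.≡-dec Fin._≟_) (Vec.≡-dec Fin._≟_) tail (tail ∘ σ)
                 (degree id id) (degree σ σ-inj) {head} (allVecs q (suc m))

  c : Vec (Fin q) (suc m) → Fin q
  c = proj₁ coloured

  enter : Transformation (Fin q) (suc m)
  enter x = c x ∷ tail x

  enter-injective : Inj enter
  enter-injective eq = proj₁ (proj₂ coloured) (∈-allVecs _) (∈-allVecs _) (cong tail eq) (cong head eq)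

  leave : Transformation (Fin q) (suc m)
  leave x = c x ∷ tail (σ x)

  leave-injective : Inj leave
  leave-injective eq = proj₂ (proj₂ coloured) (∈-allVecs _) (∈-allVecs _) (cong tail eq) (cong head eq)

  module Enter = InjectiveEndo enter enter-injective
  module Leave = InjectiveEndo leave leave-injective

  -- The points of colour `b` meet each source line once and each target line once, so they match
  -- the source lines with the target lines.
  layer : Fin q → Transformation (Fin q) m
  layer b u = tail (σ (Enter.inv (b ∷ u)))

  layer-injective : ∀ b → Inj (layer b)
  layer-injective b {u} {u′} eq = cong tail (Enter.inv-injective {b ∷ u} {b ∷ u′}
    (leave-injective (cong₂ _∷_ (trans (colour u) (sym (colour u′))) eq)))
    where
    colour : ∀ u → c (Enter.inv (b ∷ u)) ≡ b
    colour u = cong head (Enter.inverseˡ (b ∷ u))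

  layers-enter : ∀ x → layers layer (enter x) ≡ leave x
  layers-enter x = cong (λ y → c x ∷ tail (σ y)) (Enter.inverseʳ x)

-- The induction carries `e` along. The first instruction may read all of `x` and so can write
-- `c (e x)`; the tail of `e x` is a triangular map of the tail of `x`, which turns each layer into
-- a permutation after a triangular map again.
benes-routing : ∀ m (σ e : Transformation (Fin q) (suc m)) → Inj σ → Triangular e →
                Follows (benes m) (σ ∘ e)
benes-routing zero σ e σ-inj tri =
  follows-resp (zero ∷ []) single (follows-set zero (head ∘ σ ∘ e))
  where
  single : σ ∘ e ≗ set zero (head ∘ σ ∘ e)
  single x@(_ ∷ []) with σ (e x)
  ... | _ ∷ [] = refl
benes-routing {q} (suc m) σ e σ-inj (e′ , tri , tail-e) =
  c ∘ e , exit ∘ layers (λ b → layer b ∘ e′) ,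
  follows-++ (List.map suc (benes m))
    (follows-layers (benes m) (λ b → benes-routing m (layer b) e′ (layer-injective b) tri))
    (follows-set zero (head ∘ σ ∘ Leave.inv)) ,
  route
  where
  open Layered σ σ-inj
  -- `leave` is injective, so the state after the layers determines the point, and with it the first
  -- coordinate of its image under `σ`.
  exit : Transformation (Fin q) (suc (suc m))
  exit = set zero (head ∘ σ ∘ Leave.inv)
  exit-leave : ∀ x → exit (leave x) ≡ σ x
  exit-leave x = trans (cong (λ y → head (σ y) ∷ tail (σ x)) (Leave.inverseʳ x)) (head∷tail (σ x))
  route : ∀ x → σ (e x) ≡ exit (layers (λ b → layer b ∘ e′) (set zero (c ∘ e) x))
  route x@(a ∷ u) = begin
    σ (e x)                                   ≡⟨ exit-leave (e x) ⟨
    exit (leave (e x))                        ≡⟨ cong exit (layers-enter (e x)) ⟨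
    exit (layers layer (c (e x) ∷ tail (e x))) ≡⟨ cong (λ t → exit (layers layer (c (e x) ∷ t))) (tail-e x) ⟩
    exit (layers layer (c (e x) ∷ e′ u))      ∎
    where open ≡-Reasoning

-- Weights of lists and their invariance under rearrangement

weight : {Y : Set} → (Y → ℕ) → List Y → ℕ
weight w ys = sum (map w ys)

weight-++ : {Y : Set} (w : Y → ℕ) → ∀ xs ys → weight w (xs ++ ys) ≡ weight w xs + weight w ys
weight-++ w xs ys = trans (cong sum (map-++ w xs ys)) (sum-++ (map w xs) (map w ys))

weight-↭ : {Y : Set} (w : Y → ℕ) → ∀ {xs ys} → xs ↭ ys → weight w xs ≡ weight w ys
weight-↭ w p = sum-↭ (map⁺ w p)

concat-↭ : {Y : Set} {xss yss : List (List Y)} → xss ↭ yss → concat xss ↭ concat yss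
concat-↭ Perm.refl = ↭-refl
concat-↭ (Perm.prep xs p) = ++⁺ˡ xs (concat-↭ p)
concat-↭ (Perm.swap xs ys p) = ↭-trans (shifts xs ys) (++⁺ˡ ys (++⁺ˡ xs (concat-↭ p)))
concat-↭ (Perm.trans p q) = ↭-trans (concat-↭ p) (concat-↭ q)

∈⇒↭ : {Y : Set} {y : Y} {ys : List Y} → y ∈ ys → ∃[ ys′ ] ys ↭ y ∷ ys′
∈⇒↭ {y = y} y∈ with ∈-∃++ y∈
... | as , bs , refl = as ++ bs , shift y as bs

-- The Erdős-Ginzburg-Ziv theorem for a prime

module ModularSums (k : ℕ) (p-prime : Prime (suc k)) where

  p : ℕ
  p = suc k

  infix 4 _≈_
  -- A record, so that `a` and `b` can be inferred from the type.
  record _≈_ (a b : ℕ) : Set where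
    constructor congruent
    field remainders : a % p ≡ b % p

  open _≈_

  ≈-reflexive : ∀ {a b} → a ≡ b → a ≈ b
  ≈-reflexive eq = congruent (cong (_% p) eq)

  ≈-refl : ∀ {a} → a ≈ a
  ≈-refl = congruent refl

  ≈-sym : ∀ {a b} → a ≈ b → b ≈ a
  ≈-sym (congruent eq) = congruent (sym eq)

  ≈-trans : ∀ {a b c} → a ≈ b → b ≈ c → a ≈ c
  ≈-trans (congruent eq) (congruent eq′) = congruent (trans eq eq′)

  ≈-setoid : Setoid 0ℓ 0ℓ
  ≈-setoid = record { Carrier = ℕ ; _≈_ = _≈_ ; isEquivalence = record { refl = ≈-refl ; sym = ≈-sym ; trans = ≈-trans } }

  module ≈-Reasoning = SetoidReasoning ≈-setoid

  +-cong-≈ : ∀ {a a′ b b′} → a ≈ a′ → b ≈ b′ → a + b ≈ a′ + b′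
  +-cong-≈ {a} {a′} {b} {b′} (congruent eq) (congruent eq′) = congruent (trans (%-distribˡ-+ a b p)
    (trans (cong₂ (λ s t → (s + t) % p) eq eq′) (sym (%-distribˡ-+ a′ b′ p))))

  %-≈ : ∀ a → a % p ≈ a
  %-≈ a = congruent (m%n%n≡m%n a p)

  multiple≈0 : ∀ m → m * p ≈ 0
  multiple≈0 m = congruent (m*n%n≡0 m p)

  -- k is −1 modulo p.
  +-inverse-≈ : ∀ a → a + a * k ≈ 0
  +-inverse-≈ a = ≈-trans (≈-reflexive (sym (*-suc a k))) (multiple≈0 a)

  +-cancel-≈ : ∀ a {b c} → a + b ≈ a + c → b ≈ c
  +-cancel-≈ a {b} {c} eq = begin
    b                ≈⟨ absorb b ⟨
    a + b + a * k    ≈⟨ +-cong-≈ eq ≈-refl ⟩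
    a + c + a * k    ≈⟨ absorb c ⟩
    c                ∎
    where
    open ≈-Reasoning
    rearrange : ∀ a b c → a + b + c ≡ a + c + b
    rearrange = solve-∀
    absorb : ∀ b → a + b + a * k ≈ b
    absorb b = ≈-trans (≈-reflexive (rearrange a b (a * k))) (+-cong-≈ (+-inverse-≈ a) ≈-refl)

  ≈0⇒∣ : ∀ {a} → a ≈ 0 → p ∣ a
  ≈0⇒∣ {a} (congruent eq) = m%n≡0⇒n∣m a p eq

  ∣⇒≈0 : ∀ {a} → p ∣ a → a ≈ 0
  ∣⇒≈0 {a} p∣a = congruent (n∣m⇒m%n≡0 a p p∣a)

  toℕ-mod : ∀ a → toℕ (a mod p) ≈ a
  toℕ-mod a = ≈-trans (≈-reflexive (Fin.toℕ-fromℕ< (m%n<n a p))) (%-≈ a)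

  ≈⇒mod≡ : ∀ {a b} → a ≈ b → a mod p ≡ b mod p
  ≈⇒mod≡ {a} {b} (congruent eq) = Fin.toℕ-injective
    (trans (Fin.toℕ-fromℕ< (m%n<n a p)) (trans eq (sym (Fin.toℕ-fromℕ< (m%n<n b p)))))

  mod≡⇒≈ : ∀ a b → a mod p ≡ b mod p → a ≈ b
  mod≡⇒≈ a b eq = ≈-trans (≈-sym (toℕ-mod a)) (≈-trans (≈-reflexive (cong toℕ eq)) (toℕ-mod b))

  mod-toℕ : ∀ t → toℕ {p} t mod p ≡ t
  mod-toℕ t = Fin.toℕ-injective (trans (Fin.toℕ-fromℕ< (m%n<n (toℕ t) p)) (m<n⇒m%n≡m (Fin.toℕ<n t)))

  -- Cauchy-Davenport for the sum with a two-element set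

  module _ {j : ℕ} (j<p : suc j < p) (l : Fin (suc j) → Fin p) {d : ℕ} (p∤d : ¬ p ∣ d) where

    private
      Hit : Fin p → Set
      Hit t = ∃[ i ] l i ≡ t

      hit? : ∀ t → Dec (Hit t)
      hit? t = Fin.any? (λ i → l i Fin.≟ t)

      walk : ℕ → Fin p
      walk i = (toℕ (l zero) + i * d) mod p

      walk-suc : ∀ i → (toℕ (walk i) + d) mod p ≡ walk (suc i)
      walk-suc i = ≈⇒mod≡ (≈-trans (+-cong-≈ (toℕ-mod (toℕ (l zero) + i * d)) ≈-refl)
                                   (≈-reflexive (rearrange (toℕ (l zero)) i d)))
        where
        rearrange : ∀ s i d → s + i * d + d ≡ s + (d + i * d)
        rearrange = solve-∀

      first-exit : ∀ n → Hit (walk 0) → ¬ Hit (walk n) → ∃[ i ] Hit (walk i) × ¬ Hit (walk (suc i))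
      first-exit zero    h ¬h = contradiction h ¬h
      first-exit (suc n) h ¬h with hit? (walk n)
      ... | yes hₙ = n , hₙ , ¬h
      ... | no ¬hₙ = first-exit n h ¬hₙ

      -- A repetition makes `p` divide `(j ∸ i) * d`. Primality passes this to a factor, but `j ∸ i`
      -- is positive and below `p`, and `d` is not divisible by `p`.
      walk-injective : ∀ {i j} → i < j → j < p → walk i ≢ walk j
      walk-injective {i} {j} i<j j<p eq = [ p∤j∸i , p∤d ]′ (euclidsLemma (j ∸ i) d p-prime p∣)
        where
        split : toℕ (l zero) + i * d + (j ∸ i) * d ≡ toℕ (l zero) + j * d
        split = trans (+-assoc (toℕ (l zero)) _ _) (cong (toℕ (l zero) +_)
                  (trans (sym (*-distribʳ-+ d i (j ∸ i))) (cong (_* d) (m+[n∸m]≡n (<⇒≤ i<j)))))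
        p∣ : p ∣ (j ∸ i) * d
        p∣ = ≈0⇒∣ (+-cancel-≈ (toℕ (l zero) + i * d)
               (≈-trans (≈-reflexive split) (≈-trans (≈-sym (mod≡⇒≈ _ (toℕ (l zero) + j * d) eq))
                 (≈-reflexive (sym (+-identityʳ _))))))
        p∤j∸i : ¬ p ∣ j ∸ i
        p∤j∸i = >⇒∤ ⦃ >-nonZero (m<n⇒0<n∸m i<j) ⦄ (≤-<-trans (m∸n≤m j i) j<p)

    -- Otherwise the p distinct translates l zero + i d would all be hit.
    exit : ∃[ i ] ∀ i′ → l i′ ≢ (toℕ (l i) + d) mod p
    exit with Fin.all? (λ i → hit? (walk (toℕ {p} i)))
    ... | yes hits with Fin.pigeonhole j<p (proj₁ ∘ hits)
    ...   | i , i′ , i<i′ , eq = ⊥-elim (walk-injective i<i′ (Fin.toℕ<n i′)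
              (trans (sym (proj₂ (hits i))) (trans (cong l eq) (proj₂ (hits i′)))))
    exit | no ¬hits with Fin.¬∀⟶∃¬ p _ (λ i → hit? (walk (toℕ {p} i))) ¬hits
    ... | n , ¬hit with first-exit (toℕ n) (zero , start) ¬hit
      where
      start : l zero ≡ walk 0
      start = sym (trans (cong (_mod p) (+-identityʳ (toℕ (l zero)))) (mod-toℕ (l zero)))
    ...   | i , (i₀ , hit) , ¬hit′ = i₀ , λ i′ eq → ¬hit′ (i′ ,
              trans eq (trans (cong (λ t → (toℕ t + d) mod p) hit) (walk-suc i)))

  module _ {Y : Set} (w : Y → ℕ) where

    ρ : Y → ℕ
    ρ y = w y % p

    Unequal : Y × Y → Set
    Unequal (x , z) = ρ x ≢ ρ z

    flatten : List (Y × Y) → List Y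
    flatten ps = concat (map (λ (x , z) → x ∷ z ∷ []) ps)

    flatten-↭ : ∀ {ps qs} → ps ↭ qs → flatten ps ↭ flatten qs
    flatten-↭ = concat-↭ ∘ map⁺ _

    length-flatten : ∀ ps → length (flatten ps) ≡ length ps + length ps
    length-flatten []       = refl
    length-flatten (_ ∷ ps) = cong suc (trans (cong suc (length-flatten ps)) (sym (+-suc _ _)))

    base : List (Y × Y) → ℕ
    base ps = weight w (map proj₁ ps)

    Transversal : List (Y × Y) → ℕ → Set
    Transversal ps s = ∃[ G ] ∃[ D ] flatten ps ↭ G ++ D × length G ≡ length ps × weight w G ≈ s

    -- Each pair of incongruent weights enlarges the set of sums by at least one.
    transversals : ∀ ps → All Unequal ps → length ps < p →
      ∃[ l ] Inj {Fin (suc (length ps))} {Fin p} l × ∀ i → Transversal ps (base ps + toℕ (l i))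
    transversals [] _ _ = (λ _ → zero) , (λ { {zero} {zero} _ → refl }) , λ _ → [] , [] , ↭-refl , refl , ≈-refl
    transversals ((x , z) ∷ ps) (x≉z ∷ uneq) lt with transversals ps uneq (<⇒≤ lt)
    ... | l , l-inj , reach = l′ , l′-inj , reach′
      where
      -- A natural number that represents `w z` minus `w x` modulo `p`.
      d : ℕ
      d = w z + w x * k
      x+d≈z : w x + d ≈ w z
      x+d≈z = ≈-trans (≈-reflexive (rearrange (w x) (w z) (w x * k))) (+-cong-≈ (+-inverse-≈ (w x)) ≈-refl)
        where
        rearrange : ∀ a b c → a + (b + c) ≡ a + c + b
        rearrange = solve-∀
      p∤d : ¬ p ∣ d
      p∤d p∣d = x≉z (remainders (≈-trans (≈-reflexive (sym (+-identityʳ (w x))))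
        (≈-trans (+-cong-≈ ≈-refl (≈-sym (∣⇒≈0 p∣d))) x+d≈z)))
      exits = exit lt l p∤d
      i₀ = proj₁ exits
      l′ : Fin (suc (suc (length ps))) → Fin p
      -- The new sum takes `z` in place of `x` alongside the selection for `l i₀`; the old offsets
      -- survive by taking `x`, whose weight is part of the base.
      l′ zero    = (toℕ (l i₀) + d) mod p
      l′ (suc i) = l i
      l′-inj : Inj l′
      l′-inj {zero}  {zero}  _  = refl
      l′-inj {zero}  {suc i} eq = contradiction (sym eq) (proj₂ exits i)
      l′-inj {suc i} {zero}  eq = contradiction eq (proj₂ exits i)
      l′-inj {suc i} {suc j} eq = cong suc (l-inj eq)
      reach′ : ∀ i → Transversal ((x , z) ∷ ps) (w x + base ps + toℕ (l′ i))
      reach′ zero with reach i₀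
      ... | G , D , perm , len , wG = z ∷ G , x ∷ D ,
        ↭-trans (Perm.swap x z perm) (Perm.prep z (↭-sym (shift x G D))) , cong suc len ,
        (begin
          w z + weight w G                    ≈⟨ +-cong-≈ (≈-sym x+d≈z) wG ⟩
          w x + d + (base ps + toℕ (l i₀))    ≡⟨ rearrange (w x) d (base ps) _ ⟩
          w x + base ps + (toℕ (l i₀) + d)    ≈⟨ +-cong-≈ {w x + base ps} ≈-refl (toℕ-mod _) ⟨
          w x + base ps + toℕ (l′ zero)       ∎)
        where
        open ≈-Reasoning
        rearrange : ∀ a b c e → a + b + (c + e) ≡ a + c + (e + b)
        rearrange = solve-∀
      reach′ (suc i) with reach i
      ... | G , D , perm , len , wG = x ∷ G , z ∷ D ,
        Perm.prep x (↭-trans (Perm.prep z perm) (↭-sym (shift z G D))) , cong suc len ,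
        ≈-trans (+-cong-≈ ≈-refl wG) (≈-reflexive (sym (+-assoc (w x) _ _)))

    HasClass : ℕ → Y × Y → Set
    HasClass c (x , z) = ρ x ≡ c ⊎ ρ z ≡ c

    hasClass? : ∀ c pr → Dec (HasClass c pr)
    hasClass? c (x , z) = (ρ x ℕ.≟ c) ⊎-dec (ρ z ℕ.≟ c)

    -- Two or more left-over elements are tolerated only if every pair meets their class, which then
    -- has at least as many members as there are pairs and left-over elements together.
    record Pairing (ys : List Y) : Set where
      field
        pairs     : List (Y × Y)
        rest      : List Y
        class     : ℕ
        perm      : ys ↭ flatten pairs ++ rest
        unequal   : All Unequal pairs
        constant  : All (λ y → ρ y ≡ class) rest
        majority  : length rest ≤ 1 ⊎ All (HasClass class) pairs

    -- Pairs are formed greedily; when two elements of the same class are left over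
    -- and some pair avoids that class, the pair is broken up to absorb both.
    pairing : ∀ ys → Pairing ys
    pairing [] = record { pairs = [] ; rest = [] ; class = 0 ; perm = ↭-refl ; unequal = []
                        ; constant = [] ; majority = inj₁ z≤n }
    pairing (y ∷ ys) with pairing ys
    ... | record { pairs = ps ; rest = [] ; perm = perm ; unequal = uneq } = record
      { pairs = ps ; rest = y ∷ [] ; class = ρ y
      ; perm = ↭-trans (Perm.prep y perm) (↭-sym (shift y (flatten ps) []))
      ; unequal = uneq ; constant = refl ∷ [] ; majority = inj₁ ≤-refl }
    ... | record { pairs = ps ; rest = r ∷ R ; class = c ; perm = perm ; unequal = uneq
                 ; constant = r≡c ∷ R≡c ; majority = maj } with ρ y ℕ.≟ c
    ...   | no y≢c = record
      { pairs = (y , r) ∷ ps ; rest = R ; class = c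
      ; perm = Perm.prep y (↭-trans perm (shift r (flatten ps) R))
      ; unequal = (λ eq → y≢c (trans eq r≡c)) ∷ uneq ; constant = R≡c
      ; majority = [ inj₁ ∘ <⇒≤ , (λ has → inj₂ (inj₂ r≡c ∷ has)) ]′ maj }
    ...   | yes y≡c with All.all? (hasClass? c) ps
    ...     | yes has = record
      { pairs = ps ; rest = y ∷ r ∷ R ; class = c
      ; perm = ↭-trans (Perm.prep y perm) (↭-sym (shift y (flatten ps) (r ∷ R)))
      ; unequal = uneq ; constant = y≡c ∷ r≡c ∷ R≡c ; majority = inj₂ has }
    ...     | no ¬has with maj
    ...       | inj₂ has = contradiction has ¬has
    pairing (y ∷ ys) | record { pairs = ps ; rest = r ∷ (_ ∷ _) } | yes _ | no _ | inj₁ (s≤s ())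
    pairing (y ∷ ys) | record { pairs = ps ; rest = r ∷ [] ; class = c ; perm = perm ; unequal = uneq
                              ; constant = r≡c ∷ [] } | yes y≡c | no ¬has | inj₁ _
      with find (All.¬All⇒Any¬ (hasClass? c) ps ¬has)
    ... | (x , z) , pr∈ , ¬c with ∈⇒↭ pr∈
    ...   | ps′ , ps↭ = record
      { pairs = (x , y) ∷ (z , r) ∷ ps′ ; rest = [] ; class = c
      ; perm = begin
          y ∷ ys                          ↭⟨ Perm.prep y perm ⟩
          y ∷ flatten ps ++ r ∷ []        ↭⟨ Perm.prep y (++⁺ʳ (r ∷ []) (flatten-↭ ps↭)) ⟩
          y ∷ x ∷ z ∷ flatten ps′ ++ r ∷ []  ↭⟨ Perm.swap y x (Perm.prep z (shift r (flatten ps′) [])) ⟩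
          x ∷ y ∷ z ∷ r ∷ flatten ps′ ++ []  ∎
      ; unequal = (λ eq → ¬c (inj₁ (trans eq y≡c))) ∷ (λ eq → ¬c (inj₂ (trans eq r≡c)))
                  ∷ All.tail (All-resp-↭ ps↭ uneq)
      ; constant = [] ; majority = inj₁ z≤n }
      where open PermutationReasoning

    weight-constant : ∀ {c} G → All (λ y → ρ y ≡ c) G → weight w G ≈ length G * c
    weight-constant [] [] = ≈-refl
    weight-constant {c} (y ∷ G) (refl ∷ Gc) =
      +-cong-≈ (≈-sym (%-≈ (w y))) (weight-constant G Gc)

    majority-class : ∀ {c} ps → All (HasClass c) ps →
      ∃[ C ] ∃[ D ] flatten ps ↭ C ++ D × length C ≡ length ps × All (λ y → ρ y ≡ c) C
    majority-class [] [] = [] , [] , ↭-refl , refl , []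
    majority-class ((x , z) ∷ ps) (has ∷ hass) with majority-class ps hass
    ... | C , D , perm , len , Cc with has
    ...   | inj₁ xc = x ∷ C , z ∷ D ,
            Perm.prep x (↭-trans (Perm.prep z perm) (↭-sym (shift z C D))) , cong suc len , xc ∷ Cc
    ...   | inj₂ zc = z ∷ C , x ∷ D ,
            ↭-trans (Perm.swap x z perm) (Perm.prep z (↭-sym (shift x C D))) , cong suc len , zc ∷ Cc

    ZeroSum : List Y → Set
    ZeroSum ys = ∃[ G ] ∃[ R ] ys ↭ G ++ R × length G ≡ p × p ∣ weight w G

    odd≢even : ∀ m n → suc (m + m) ≢ n + n
    odd≢even m zero ()
    odd≢even zero (suc zero) ()
    odd≢even zero (suc (suc n)) ()
    odd≢even (suc m) (suc n) eq = odd≢even m n (suc-injective (suc-injective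
      (trans (sym (cong (λ t → suc (suc t)) (+-suc m m))) (trans eq (cong suc (+-suc n n))))))

    double-injective : ∀ m n → m + m ≡ n + n → m ≡ n
    double-injective zero zero _ = refl
    double-injective (suc m) (suc n) eq = cong suc (double-injective m n (suc-injective (suc-injective
      (trans (sym (cong suc (+-suc m m))) (trans eq (cong suc (+-suc n n)))))))

    -- With one element left over there are `k` pairs, whose selections attain all `p` residues; one
    -- of them cancels the left-over element. Otherwise one element from each pair joins the rest:
    -- there are at most `k` pairs among `2k + 1` elements, so at least `p` elements are congruent,
    -- and any `p` of these have sum zero.
    erdős-ginzburg-ziv : ∀ ys → length ys ≡ suc (k + k) → ZeroSum ys
    erdős-ginzburg-ziv ys len = go (pairing ys)
      where
      total : ∀ ps R → ys ↭ flatten ps ++ R → (length ps + length ps) + length R ≡ suc (k + k)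
      total ps R perm = trans (cong (_+ length R) (sym (length-flatten ps)))
        (trans (sym (length-++ (flatten ps))) (trans (sym (↭-length perm)) len))

      from-pairs : ∀ ps r → ys ↭ flatten ps ++ r ∷ [] → All Unequal ps → length ps ≡ k → ZeroSum ys
      from-pairs ps r perm uneq refl with transversals ps uneq ≤-refl
      -- The offset sought is the negative of `w r + base ps`, as multiplication by `k` changes the
      -- sign modulo `p`.
      ... | l , l-inj , reach with injective⇒surjective l-inj (((w r + base ps) * k) mod p)
      ...   | i , eq with reach i
      ...     | G , D , perm′ , len′ , wG = r ∷ G , D ,
        (begin
          ys                       ↭⟨ perm ⟩
          flatten ps ++ r ∷ []     ↭⟨ shift r (flatten ps) [] ⟩
          r ∷ flatten ps ++ []     ↭⟨ Perm.prep r (++-identityʳ _) ⟩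
          r ∷ flatten ps           ↭⟨ Perm.prep r perm′ ⟩
          r ∷ G ++ D               ∎)
        , cong suc len′
        , ≈0⇒∣ (≈-trans (+-cong-≈ ≈-refl wG)
            (≈-trans (≈-reflexive (sym (+-assoc (w r) (base ps) _)))
            (≈-trans (+-cong-≈ ≈-refl (≈-trans (≈-reflexive (cong toℕ eq)) (toℕ-mod _)))
                     (+-inverse-≈ (w r + base ps)))))
        where open PermutationReasoning

      from-majority : ∀ ps R {c} → ys ↭ flatten ps ++ R → All (HasClass c) ps →
                      All (λ y → ρ y ≡ c) R → ZeroSum ys
      from-majority ps R {c} perm has Rc with majority-class ps has
      ... | C , D , perm′ , lenC , Cc = take p M , drop p M ++ D ,
        (begin
          ys                              ↭⟨ perm ⟩
          flatten ps ++ R                 ↭⟨ ++⁺ʳ R perm′ ⟩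
          (C ++ D) ++ R                   ↭⟨ ++-assoc C D R ⟩
          C ++ D ++ R                     ↭⟨ ++⁺ˡ C (++-comm D R) ⟩
          C ++ R ++ D                     ↭⟨ ++-assoc C R D ⟨
          M ++ D                          ≡⟨ cong (_++ D) (take++drop≡id p M) ⟨
          (take p M ++ drop p M) ++ D     ↭⟨ ++-assoc (take p M) (drop p M) D ⟩
          take p M ++ drop p M ++ D       ∎)
        , len-take
        , ≈0⇒∣ (≈-trans (weight-constant (take p M) (All.take⁺ p (All.++⁺ Cc Rc)))
                 (≈-trans (≈-reflexive (trans (cong (_* c) len-take) (*-comm p c))) (multiple≈0 c)))
        where
        open PermutationReasoning
        M : List Y
        M = C ++ R
        lenM : length M ≡ length ps + length R
        lenM = trans (length-++ C) (cong (_+ length R) lenC)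
        few : length ps ≤ k
        few with length ps ≤? k
        ... | yes le = le
        ... | no ¬le = contradiction (≤-trans (+-mono-≤ (≰⇒> ¬le) (≰⇒> ¬le)) (≤-trans (m≤m+n _ _) (≤-reflexive (total ps R perm))))
                         (<⇒≱ (s≤s (≤-reflexive (sym (+-suc k k)))))
        p≤M : p ≤ length M
        p≤M = +-cancelˡ-≤ k p (length M) (≤-trans (≤-reflexive (trans (+-suc k k) (sym (total ps R perm))))
                (≤-trans (≤-reflexive (+-assoc (length ps) (length ps) (length R)))
                  (+-mono-≤ few (≤-reflexive (sym lenM)))))
        len-take : length (take p M) ≡ p
        len-take = trans (length-take p M) (m≤n⇒m⊓n≡m p≤M)

      go : Pairing ys → ZeroSum ys
      go record { pairs = ps ; rest = R ; perm = perm ; constant = Rc ; majority = inj₂ has } =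
        from-majority ps R perm has Rc
      go record { pairs = ps ; rest = [] ; perm = perm ; majority = inj₁ _ } =
        ⊥-elim (odd≢even k (length ps) (sym (trans (sym (+-identityʳ _)) (total ps [] perm))))
      go record { pairs = ps ; rest = r ∷ [] ; perm = perm ; unequal = uneq ; majority = inj₁ _ } =
        from-pairs ps r perm uneq (double-injective _ _ (suc-injective
          (trans (sym (+-comm _ 1)) (total ps (r ∷ []) perm))))
      go record { rest = _ ∷ _ ∷ _ ; majority = inj₁ (s≤s ()) }

-- Splitting a list into groups of size q with weights divisible by q

-- The quantifier over `Y` lets the product case apply the property a second time, with whole groups
-- as elements.
Grouping : ℕ → Set₁
Grouping q = ∀ {Y : Set} (w : Y → ℕ) N ys → length ys ≡ N * q → q ∣ weight w ys →
  ∃[ gs ] ys ↭ concat gs × All (λ g → length g ≡ q × q ∣ weight w g) gs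

grouping-prime : ∀ {p} → Prime p → Grouping p
grouping-prime {suc k} p-prime w = go
  where
  open ModularSums k p-prime

  -- At least `2p` elements remain, so the first `2p − 1` contain a group of weight zero modulo `p`;
  -- removing it keeps the total divisible.
  extract : ∀ N ys → length ys ≡ suc (suc N) * p → p ∣ weight w ys →
    ∃[ G ] ∃[ R ] ys ↭ G ++ R × length G ≡ p × p ∣ weight w G × length R ≡ suc N * p × p ∣ weight w R
  extract N ys len p∣ with erdős-ginzburg-ziv w (take (suc (k + k)) ys)
    (trans (length-take (suc (k + k)) ys) (m≤n⇒m⊓n≡m (≤-trans
      (≤-trans (+-monoʳ-≤ (suc k) (n≤1+n k)) (+-monoʳ-≤ p (m≤m+n p (N * p))))
      (≤-reflexive (sym len)))))
  ... | G , R , perm , lenG , p∣G = G , R′ , ys↭ , lenG , p∣G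
      , +-cancelˡ-≡ p _ _ (trans (cong (_+ length R′) (sym lenG))
          (trans (sym (length-++ G)) (trans (sym (↭-length ys↭)) len)))
      , ∣m+n∣m⇒∣n (subst (p ∣_) (trans (weight-↭ w ys↭) (weight-++ w G R′)) p∣) p∣G
    where
    R′ : List _
    R′ = R ++ drop (suc (k + k)) ys
    ys↭ : ys ↭ G ++ R′
    ys↭ = begin
      ys                                                    ≡⟨ take++drop≡id (suc (k + k)) ys ⟨
      take (suc (k + k)) ys ++ drop (suc (k + k)) ys        ↭⟨ ++⁺ʳ _ perm ⟩
      (G ++ R) ++ drop (suc (k + k)) ys                     ↭⟨ ++-assoc G R _ ⟩
      G ++ R′                                               ∎
      where open PermutationReasoning

  go : ∀ N ys → length ys ≡ N * p → p ∣ weight w ys →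
       ∃[ gs ] ys ↭ concat gs × All (λ g → length g ≡ p × p ∣ weight w g) gs
  go zero [] _ _ = [] , ↭-refl , []
  -- The last `p` elements are too few for an extraction, but the divisibility of the total makes
  -- them a group.
  go (suc zero) ys len p∣ = ys ∷ [] , ↭-sym (++-identityʳ ys) ,
                            (trans len (+-identityʳ p) , p∣) ∷ []
  go (suc (suc N)) ys len p∣ =
    let G , R , ys↭ , lenG , p∣G , lenR , p∣R = extract N ys len p∣
        gs , R↭ , good = go (suc N) R lenR p∣R
    in G ∷ gs , ↭-trans ys↭ (++⁺ˡ G R↭) , (lenG , p∣G) ∷ good

length-concat : {Y : Set} {a : ℕ} {gs : List (List Y)} → All (λ g → length g ≡ a) gs →
                length (concat gs) ≡ length gs * a
length-concat [] = refl
length-concat {gs = g ∷ gs} (len ∷ lens) = trans (length-++ g) (cong₂ _+_ len (length-concat lens))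

grouping-1 : Grouping 1
grouping-1 w N ys len _ = map [_] ys , ↭-reflexive (sym (concat-map-[ ys ])) ,
  All.map⁺ (All.universal (λ y → refl , 1∣ _) ys)

-- The groups of size `a` are regarded as elements whose weight is their sum divided by `a`. These
-- weights have a total divisible by `b`, and joining the groups `b` at a time gives sums divisible
-- by `a * b`.
grouping-* : ∀ {a b} → .⦃ NonZero a ⦄ → Grouping a → Grouping b → Grouping (a * b)
grouping-* {a} {b} grp-a grp-b {Y} w N ys len ab∣
  with grp-a w (N * b) ys (trans len (trans (cong (N *_) (*-comm a b)) (sym (*-assoc N b a))))
         (∣-trans (m∣m*n b) ab∣)
... | gs , ys↭ , good = result
  where
  w′ : List Y → ℕ
  w′ g = weight w g / a
  weight-concat : ∀ hs → All (λ g → length g ≡ a × a ∣ weight w g) hs →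
                  weight w (concat hs) ≡ weight w′ hs * a
  weight-concat [] [] = refl
  weight-concat (h ∷ hs) ((_ , a∣) ∷ hs-good) = begin
    weight w (h ++ concat hs)              ≡⟨ weight-++ w h (concat hs) ⟩
    weight w h + weight w (concat hs)      ≡⟨ cong₂ _+_ (sym (m/n*n≡m a∣)) (weight-concat hs hs-good) ⟩
    w′ h * a + weight w′ hs * a            ≡⟨ *-distribʳ-+ a (w′ h) (weight w′ hs) ⟨
    (w′ h + weight w′ hs) * a              ∎
    where open ≡-Reasoning
  len-gs : length gs ≡ N * b
  len-gs = *-cancelʳ-≡ (length gs) (N * b) a (begin
    length gs * a          ≡⟨ length-concat (All.map proj₁ good) ⟨
    length (concat gs)     ≡⟨ ↭-length ys↭ ⟨
    length ys              ≡⟨ len ⟩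
    N * (a * b)            ≡⟨ cong (N *_) (*-comm a b) ⟩
    N * (b * a)            ≡⟨ *-assoc N b a ⟨
    N * b * a              ∎)
    where open ≡-Reasoning
  b∣ : b ∣ weight w′ gs
  b∣ = *-cancelʳ-∣ a (subst₂ _∣_ (*-comm a b)
         (trans (weight-↭ w ys↭) (weight-concat gs good)) ab∣)
  finish : ∀ hs → All (All (λ g → length g ≡ a × a ∣ weight w g)) hs →
           All (λ h → length h ≡ b × b ∣ weight w′ h) hs →
           All (λ g → length g ≡ a * b × a * b ∣ weight w g) (map concat hs)
  finish [] [] [] = []
  finish (h ∷ hs) (h-good ∷ hs-good) ((len-h , b∣h) ∷ rest) =
    ( trans (length-concat (All.map proj₁ h-good)) (trans (cong (_* a) len-h) (*-comm b a))
    , subst₂ _∣_ (*-comm b a) (sym (weight-concat h h-good)) (*-monoˡ-∣ a b∣h)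
    ) ∷ finish hs hs-good rest
  result : ∃[ gs ] ys ↭ concat gs × All (λ g → length g ≡ a * b × a * b ∣ weight w g) gs
  result with grp-b w′ N gs len-gs b∣
  ... | hs , gs↭ , good′ = map concat hs ,
        ↭-trans ys↭ (↭-trans (concat-↭ gs↭) (↭-reflexive (sym (concat-concat hs)))) ,
        finish hs (All.concat⁻ (All-resp-↭ gs↭ good)) good′

grouping : ∀ q → .⦃ NonZero q ⦄ → Grouping q
grouping q = subst Grouping (sym isFactorisation) (go factorsPrime)
  where
  open PrimeFactorisation (factorise q)
  go : ∀ {ps} → All Prime ps → Grouping (product ps)
  go [] = grouping-1
  go (p-prime ∷ primes) = grouping-* ⦃ prime⇒nonZero p-prime ⦄ (grouping-prime p-prime) (go primes)

-- Fibres, and partitions into blocks of equal size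

module Fibres {X Y : Set} (_≟_ : DecidableEquality Y) (f : X → Y) where

  fibre : List X → Y → List X
  fibre xs y = filter (λ x → f x ≟ y) xs

  fibreSize : List X → Y → ℕ
  fibreSize xs y = length (fibre xs y)

  private
    fibreSize-∉ : ∀ x xs ys → f x ∉ ys → weight (fibreSize (x ∷ xs)) ys ≡ weight (fibreSize xs) ys
    fibreSize-∉ x xs [] _ = refl
    fibreSize-∉ x xs (y ∷ ys) ∉ys with f x ≟ y
    ... | yes eq = contradiction (here eq) ∉ys
    ... | no _   = cong (fibreSize xs y +_) (fibreSize-∉ x xs ys (∉ys ∘ there))

    fibreSize-∈ : ∀ x xs ys → Unique ys → f x ∈ ys →
                  weight (fibreSize (x ∷ xs)) ys ≡ suc (weight (fibreSize xs) ys)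
    fibreSize-∈ x xs (y ∷ ys) (y∉ ∷ uniq) fx∈ with f x ≟ y
    ... | yes refl = cong (λ t → suc (fibreSize xs y + t)) (fibreSize-∉ x xs ys (All.All¬⇒¬Any y∉))
    fibreSize-∈ x xs (y ∷ ys) (y∉ ∷ uniq) (here eq)   | no ¬eq = contradiction eq ¬eq
    fibreSize-∈ x xs (y ∷ ys) (y∉ ∷ uniq) (there fx∈) | no _ =
      trans (cong (fibreSize xs y +_) (fibreSize-∈ x xs ys uniq fx∈)) (+-suc _ _)

  weight-fibreSize : ∀ xs ys → Unique ys → (∀ x → f x ∈ ys) → weight (fibreSize xs) ys ≡ length xs
  weight-fibreSize [] ys _ _ = zeros ys
    where
    zeros : ∀ ys → weight (fibreSize []) ys ≡ 0
    zeros []       = refl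
    zeros (_ ∷ ys) = zeros ys
  weight-fibreSize (x ∷ xs) ys uniq covers = trans (fibreSize-∈ x xs ys uniq (covers x))
    (cong suc (weight-fibreSize xs ys uniq covers))

  preimage : List X → List Y → List X
  preimage xs ys = concat (map (fibre xs) ys)

  preimage-++ : ∀ xs ys zs → preimage xs (ys ++ zs) ≡ preimage xs ys ++ preimage xs zs
  preimage-++ xs ys zs = trans (cong concat (map-++ (fibre xs) ys zs))
                               (sym (concat-++ (map (fibre xs) ys) (map (fibre xs) zs)))

  length-preimage : ∀ xs ys → length (preimage xs ys) ≡ weight (fibreSize xs) ys
  length-preimage xs []       = refl
  length-preimage xs (y ∷ ys) = trans (length-++ (fibre xs y)) (cong (fibreSize xs y +_) (length-preimage xs ys))

  ∈-preimage⁺ : ∀ {x xs ys} → x ∈ xs → f x ∈ ys → x ∈ preimage xs ys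
  ∈-preimage⁺ {xs = xs} x∈ fx∈ = ∈-concat⁺′ (∈-filter⁺ _ x∈ refl) (∈-map⁺ (fibre xs) fx∈)

  ∈-preimage⁻ : ∀ {x xs ys} → x ∈ preimage xs ys → f x ∈ ys
  ∈-preimage⁻ {xs = xs} {ys} x∈ with ∈-concat⁻′ (map (fibre xs) ys) x∈
  ... | c , x∈c , c∈ with ∈-map⁻ (fibre xs) c∈
  ...   | y , y∈ , refl with ∈-filter⁻ (λ x → f x ≟ y) {xs = xs} x∈c
  ...     | _ , refl = y∈

chunks : ∀ {X : Set} {q} c (xs : List X) → length xs ≡ c * q →
         ∃[ cs ] concat cs ≡ xs × All (λ c → length c ≡ q) cs
chunks zero    [] _ = [] , refl , []
chunks {q = q} (suc c) xs len with chunks c (drop q xs)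
  (trans (length-drop q xs) (trans (cong (_∸ q) len) (m+n∸m≡n q (c * q))))
... | cs , eq , lens = take q xs ∷ cs , trans (cong (take q xs ++_) eq) (take++drop≡id q xs) ,
  trans (length-take q xs) (m≤n⇒m⊓n≡m (≤-trans (m≤m+n q (c * q)) (≤-reflexive (sym len)))) ∷ lens

-- A partition of A^(m+1) into blocks of size q, read as a relabelling under
-- which the blocks become the lines parallel to the first axis.
record Blocks {q m} (css : List (List (Vec (Fin q) (suc m)))) : Set where
  field
    relabel           : Transformation (Fin q) (suc m)
    relabel-injective : Inj relabel
    block             : Vec (Fin q) m → List (Vec (Fin q) (suc m))
    block∈            : ∀ u → block u ∈ css
    ∈-block           : ∀ x → x ∈ block (tail (relabel x))
    block-unique      : ∀ {x u} → x ∈ block u → tail (relabel x) ≡ u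
    block-surjective  : ∀ {c} → c ∈ css → ∃[ u ] block u ≡ c

-- A point is relabelled by its position in a block and the number of that block. Disjointness of
-- the blocks comes from counting: they have `q ^ m * q` places in all and cover as many points, so
-- the injective `relabel` is a bijection and each point has a single place.
blocks : ∀ {q m} (css : List (List (Vec (Fin q) (suc m)))) → All (λ c → length c ≡ q) css →
         length css ≡ q ^ m → (∀ x → x ∈ concat css) → Blocks css
blocks {q} {m} css lens len covers = record
  { relabel = relabel
  ; relabel-injective = relabel-injective
  ; block = block
  ; block∈ = λ u → ∈-lookup (index u)
  ; ∈-block = λ x → subst (λ j → x ∈ List.lookup css j) (sym (index-tail x)) (lookup-index (find-block x))
  ; block-unique = λ {x} {u} → block-unique x u
  ; block-surjective = λ c∈ → decode q m (cast len (Any.index c∈)) ,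
      trans (cong (List.lookup css) (index-decode (Any.index c∈))) (sym (lookup-index c∈))
  }
  where
  X : Set
  X = Vec (Fin q) (suc m)

  len-lookup : ∀ j → length (List.lookup css j) ≡ q
  len-lookup j = All.lookup lens (∈-lookup j)

  index : Vec (Fin q) m → Fin (length css)
  index u = cast (sym len) (encode u)

  block : Vec (Fin q) m → List X
  block u = List.lookup css (index u)

  index-decode : ∀ j → index (decode q m (cast len j)) ≡ j
  index-decode j = trans (cong (cast (sym len)) (encode-decode q m (cast len j))) (Fin.cast-involutive (sym len) len j)

  entry : X → X
  entry (a ∷ u) = List.lookup (block u) (cast (sym (len-lookup (index u))) a)

  find-block : ∀ x → Any (x ∈_) css
  find-block x = ∈-concat⁻ css (covers x)

  relabel : X → X
  relabel x = cast (len-lookup _) (Any.index (lookup-index (find-block x))) ∷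
              decode q m (cast len (Any.index (find-block x)))

  index-tail : ∀ x → index (tail (relabel x)) ≡ Any.index (find-block x)
  index-tail x = index-decode _

  entry-lookup : ∀ {j} u → index u ≡ j → ∀ i → entry (cast (len-lookup j) i ∷ u) ≡ List.lookup (List.lookup css j) i
  entry-lookup u refl i = cong (List.lookup (block u)) (Fin.cast-involutive (sym (len-lookup (index u))) (len-lookup (index u)) i)

  entry-relabel : ∀ x → entry (relabel x) ≡ x
  entry-relabel x = trans (entry-lookup (tail (relabel x)) (index-tail x) _) (sym (lookup-index (lookup-index (find-block x))))

  relabel-injective : Inj relabel
  relabel-injective {x} {y} eq = trans (sym (entry-relabel x)) (trans (cong entry eq) (entry-relabel y))

  open InjectiveEndo relabel relabel-injective

  relabel-entry : ∀ z → relabel (entry z) ≡ z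
  relabel-entry z = trans (cong (relabel ∘ entry) (sym (inverseˡ z)))
    (trans (cong relabel (entry-relabel (inv z))) (inverseˡ z))

  block-unique : ∀ x u → x ∈ block u → tail (relabel x) ≡ u
  block-unique x u x∈ = trans (cong (tail ∘ relabel)
      (trans (lookup-index x∈) (sym (entry-lookup u refl (Any.index x∈)))))
    (cong tail (relabel-entry _))

length-allVecs : ∀ q n → length (allVecs q n) ≡ q ^ n
length-allVecs q n = trans (length-map (decode q n) (allFin (q ^ n))) (length-tabulate id)

allVecs-unique : ∀ q n → Unique (allVecs q n)
allVecs-unique q n = Unique.map⁺ (decode-injective {q} {n}) (Unique.allFin⁺ (q ^ n))

-- Factorisation into a permutation, a triangular map and a permutation

module LineStructure {q m} ⦃ _ : NonZero q ⦄ (f : Transformation (Fin q) (suc m)) where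

  private
    X : Set
    X = Vec (Fin q) (suc m)

    _≟_ : DecidableEquality X
    _≟_ = Vec.≡-dec Fin._≟_

    all : List X
    all = allVecs q (suc m)

    open Fibres _≟_ f

    size : X → ℕ
    size = fibreSize all

    length-all : length all ≡ q ^ m * q
    length-all = trans (length-allVecs q (suc m)) (*-comm q (q ^ m))

    weight-all : weight size all ≡ q ^ m * q
    weight-all = trans (weight-fibreSize all all (allVecs-unique q (suc m)) (λ x → ∈-allVecs (f x))) length-all

    groups = grouping q size (q ^ m) all length-all (divides (q ^ m) weight-all)

    gs : List (List X)
    gs = proj₁ groups

    gs↭ : all ↭ concat gs
    gs↭ = proj₁ (proj₂ groups)

    target : Blocks gs
    target = blocks gs lens
      (*-cancelʳ-≡ (length gs) (q ^ m) q (trans (sym (length-concat lens)) (trans (sym (↭-length gs↭)) length-all)))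
      (λ x → ∈-resp-↭ gs↭ (∈-allVecs x))
      where lens = All.map proj₁ (proj₂ (proj₂ groups))

    -- The preimage of a group has as many points as its fibre sizes add up to, a multiple of `q`.
    -- Any cut into blocks of `q` points will do, as all of them are mapped into that group.
    refine : ∀ hs → All (λ h → q ∣ weight size h) hs →
      ∃[ cs ] concat cs ≡ preimage all (concat hs) × All (λ c → length c ≡ q) cs ×
              All (λ c → Any (λ h → All (λ x → f x ∈ h) c) hs) cs
    refine [] [] = [] , refl , [] , []
    refine (h ∷ hs) (divides k eq ∷ q∣) with chunks k (preimage all h) (trans (length-preimage all h) eq) | refine hs q∣
    ... | cs , cs≡ , lens | ds , ds≡ , lens′ , into =
      cs ++ ds ,
      trans (sym (concat-++ cs ds)) (trans (cong₂ _++_ cs≡ ds≡) (sym (preimage-++ all h (concat hs)))) ,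
      All.++⁺ lens lens′ ,
      All.++⁺ (All.map here (All.concat⁻ {xss = cs} (subst (All (λ x → f x ∈ h)) (sym cs≡) (All.tabulate (∈-preimage⁻ {xs = all})))))
              (All.map there into)

    chunked = refine gs (All.map proj₂ (proj₂ (proj₂ groups)))

    cs : List (List X)
    cs = proj₁ chunked

    source : Blocks cs
    source = blocks cs lens
      (*-cancelʳ-≡ (length cs) (q ^ m) q (begin
        length cs * q                          ≡⟨ length-concat lens ⟨
        length (concat cs)                     ≡⟨ cong length cs≡ ⟩
        length (preimage all (concat gs))      ≡⟨ length-preimage all (concat gs) ⟩
        weight size (concat gs)                ≡⟨ weight-↭ size gs↭ ⟨
        weight size all                        ≡⟨ weight-all ⟩
        q ^ m * q                              ∎))
      (λ x → subst (x ∈_) (sym cs≡) (∈-preimage⁺ {xs = all} (∈-allVecs x) (∈-resp-↭ gs↭ (∈-allVecs (f x)))))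
      where
      open ≡-Reasoning
      cs≡ = proj₁ (proj₂ chunked)
      lens = proj₁ (proj₂ (proj₂ chunked))

    into : ∀ u → Any (λ h → All (λ x → f x ∈ h) (Blocks.block source u)) gs
    into u = All.lookup (proj₂ (proj₂ (proj₂ chunked))) (Blocks.block∈ source u)

    image : ∀ u → ∃[ v ] ∀ {x} → x ∈ Blocks.block source u → f x ∈ Blocks.block target v
    image u =
      let g , g∈ , f∈g = find (into u)
          v , eq = Blocks.block-surjective target g∈
      in v , λ x∈ → subst (f _ ∈_) (sym eq) (All.lookup f∈g x∈)

  open Blocks source public using () renaming (relabel to relabelˢ; relabel-injective to relabelˢ-injective)
  open Blocks target public using () renaming (relabel to relabelᵗ; relabel-injective to relabelᵗ-injective)

  quotient : Transformation (Fin q) m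
  quotient = proj₁ ∘ image

  quotient-commutes : ∀ x → tail (relabelᵗ (f x)) ≡ quotient (tail (relabelˢ x))
  quotient-commutes x = Blocks.block-unique target {u = quotient (tail (relabelˢ x))}
    (proj₂ (image (tail (relabelˢ x))) (Blocks.∈-block source x))

-- The permutations found for the quotient act on lines and keep the position within a line. The
-- position of the image may depend on the whole point, which is just what a triangular map allows
-- its first coordinate.
triangularize : ∀ {q} ⦃ _ : NonZero q ⦄ n (f : Transformation (Fin q) n) →
  ∃[ τ ] ∃[ e ] ∃[ π ] Inj τ × Triangular {q} {n} e × Inj π × f ≗ τ ∘ e ∘ π
triangularize zero f = id , f , id , id , tt , id , λ _ → refl
triangularize {q} (suc m) f = step (triangularize m quotient)
  where
  open LineStructure f
  module Target = InjectiveEndo relabelᵗ relabelᵗ-injective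
  module Source = InjectiveEndo relabelˢ relabelˢ-injective

  step : ∃[ τ ] ∃[ e ] ∃[ π ] Inj τ × Triangular {q} {m} e × Inj π × quotient ≗ τ ∘ e ∘ π →
         ∃[ τ ] ∃[ e ] ∃[ π ] Inj τ × Triangular {q} {suc m} e × Inj π × f ≗ τ ∘ e ∘ π
  step (τ′ , e′ , π′ , τ′-inj , tri , π′-inj , eq) =
    τ , e , π , τ-inj , (e′ , tri , λ { (_ ∷ _) → refl }) , π-inj , factor
    where
    open module Π′ = InjectiveEndo π′ π′-inj
    k : Transformation (Fin q) (suc m)
    k = relabelᵗ ∘ f ∘ Source.inv
    τ e π : Transformation (Fin q) (suc m)
    τ y = Target.inv (head y ∷ τ′ (tail y))
    -- The tail has already been moved by `π′`; `inv` undoes this before `k`, which is `f` between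
    -- the relabelled spaces, is consulted.
    e x = head (k (head x ∷ inv (tail x))) ∷ e′ (tail x)
    π x = head (relabelˢ x) ∷ π′ (tail (relabelˢ x))
    τ-inj : Inj τ
    τ-inj {a ∷ u} {b ∷ v} eq =
      let eq′ = Target.inv-injective {a ∷ τ′ u} {b ∷ τ′ v} eq
      in cong₂ _∷_ (cong head eq′) (τ′-inj (cong tail eq′))
    π-inj : Inj π
    π-inj {x} {y} eq = relabelˢ-injective (trans (sym (head∷tail (relabelˢ x)))
      (trans (cong₂ _∷_ (cong head eq) (π′-inj (cong tail eq))) (head∷tail (relabelˢ y))))
    factor : f ≗ τ ∘ e ∘ π
    factor x = begin
      f x                                          ≡⟨ Target.inverseʳ (f x) ⟨
      Target.inv (relabelᵗ (f x))                  ≡⟨ cong Target.inv (head∷tail (relabelᵗ (f x))) ⟨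
      Target.inv (head (relabelᵗ (f x)) ∷ tail (relabelᵗ (f x)))
        ≡⟨ cong₂ (λ a u → Target.inv (a ∷ u)) heads tails ⟩
      τ (e (π x))                                  ∎
      where
      open ≡-Reasoning
      heads : head (relabelᵗ (f x)) ≡ head (e (π x))
      heads = cong (head ∘ relabelᵗ ∘ f) (sym (trans
        (cong Source.inv (trans (cong (head (relabelˢ x) ∷_) (inverseʳ _)) (head∷tail (relabelˢ x))))
        (Source.inverseʳ x)))
      tails : tail (relabelᵗ (f x)) ≡ τ′ (tail (e (π x)))
      tails = trans (quotient-commutes x) (eq _)

-- Transport of programs along a bijection of alphabets

computable-resp : ∀ {a} {A : Set a} {n L} {f g : Transformation A n} →
                  f ≗ g → ComputableInLength f L → ComputableInLength g L
computable-resp f≗g (p , p≗f) = p , λ x → trans (p≗f x) (f≗g x)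

module Conjugate {a b : Level} {A : Set a} {B : Set b} (i : A ↔ B) where

  open Inverse i using (to; from; strictlyInverseˡ; strictlyInverseʳ)

  conj : ∀ {n} → Transformation A n → Transformation B n
  conj f = Vec.map to ∘ f ∘ Vec.map from

  map-from-to : ∀ {n} (x : Vec A n) → Vec.map from (Vec.map to x) ≡ x
  map-from-to x = trans (sym (Vec.map-∘ from to x)) (trans (Vec.map-cong strictlyInverseʳ x) (Vec.map-id x))

  map-to-from : ∀ {n} (x : Vec B n) → Vec.map to (Vec.map from x) ≡ x
  map-to-from x = trans (sym (Vec.map-∘ to from x)) (trans (Vec.map-cong strictlyInverseˡ x) (Vec.map-id x))

  conj-instruction : ∀ {n} {g : Transformation A n} → IsInstruction g → IsInstruction (conj g)
  conj-instruction {g = g} g-instr j k ¬tj ¬tk = g-instr j k (¬tj ∘ conj-trivial j) (¬tk ∘ conj-trivial k)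
    where
    conj-trivial : ∀ j → Trivial g j → Trivial (conj g) j
    conj-trivial j t x = begin
      lookup (conj g x) j                   ≡⟨ Vec.lookup-map j to (g (Vec.map from x)) ⟩
      to (lookup (g (Vec.map from x)) j)    ≡⟨ cong to (t (Vec.map from x)) ⟩
      to (lookup (Vec.map from x) j)        ≡⟨ cong to (Vec.lookup-map j from x) ⟩
      to (from (lookup x j))                ≡⟨ strictlyInverseˡ (lookup x j) ⟩
      lookup x j                            ∎
      where open ≡-Reasoning

  conj-program : ∀ {n L} (p : Program A n L) → ComputableInLength (conj ⟦ p ⟧) L
  conj-program []              = [] , λ x → sym (map-to-from x)
  conj-program ((g , g-instr) ∷ p) with conj-program p
  ... | p′ , eq = (conj g , conj-instruction {g = g} g-instr) ∷ p′ , λ x →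
        trans (eq _) (cong (Vec.map to ∘ ⟦ p ⟧) (map-from-to (g (Vec.map from x))))

  conj-computable : ∀ {n L} {f : Transformation A n} → ComputableInLength f L → ComputableInLength (conj f) L
  conj-computable (p , p≗f) = computable-resp (λ x → cong (Vec.map to) (p≗f (Vec.map from x))) (conj-program p)

-- Existence of a least program length

least : ∀ {p} {P : ℕ → Set p} → (∀ n → Dec (P n)) → ∀ n → P n →
        ∃[ m ] P m × (∀ k → P k → m ≤ k) × m ≤ n
least {P = P} P? = <-rec _ search
  where
  search : ∀ n → (∀ {m} → m < n → P m → ∃[ l ] P l × (∀ k → P k → l ≤ k) × l ≤ m) →
           P n → ∃[ l ] P l × (∀ k → P k → l ≤ k) × l ≤ n
  search n rec Pn with anyUpTo? P? n
  ... | yes (m , m<n , Pm) = let l , Pl , min , l≤m = rec m<n Pm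
                             in l , Pl , min , ≤-trans l≤m (<⇒≤ m<n)
  ... | no none = n , Pn , (λ k Pk → ≮⇒≥ (λ k<n → none (k , k<n , Pk))) , ≤-refl

module _ (q n : ℕ) where

  private
    M : ℕ
    M = q ^ n

    table : Fin (M ^ M) → Transformation (Fin q) n
    table t = decode q n ∘ finToFun t ∘ encode

    index : Transformation (Fin q) n → Fin (M ^ M)
    index f = funToFin (encode ∘ f ∘ decode q n)

    table-index : ∀ f → table (index f) ≗ f
    table-index f x = begin
      decode q n (finToFun (index f) (encode x))         ≡⟨ cong (decode q n) (Fin.finToFun-funToFin (encode ∘ f ∘ decode q n) (encode x)) ⟩
      decode q n (encode (f (decode q n (encode x))))    ≡⟨ decode-encode _ ⟩
      f (decode q n (encode x))                          ≡⟨ cong f (decode-encode x) ⟩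
      f x                                                ∎
      where open ≡-Reasoning

    allVecs? : ∀ {p} {P : Vec (Fin q) n → Set p} → (∀ x → Dec (P x)) → Dec (∀ x → P x)
    allVecs? {P = P} P? = map′ (λ h x → subst P (decode-encode x) (h (encode x))) (λ h k → h (decode q n k))
                               (Fin.all? (P? ∘ decode q n))

    _≗?_ : (f g : Transformation (Fin q) n) → Dec (f ≗ g)
    f ≗? g = allVecs? (λ x → Vec.≡-dec Fin._≟_ (f x) (g x))

    trivial? : ∀ (f : Transformation (Fin q) n) i → Dec (Trivial f i)
    trivial? f i = allVecs? (λ x → coordinate f i x Fin.≟ lookup x i)

    isInstruction? : (f : Transformation (Fin q) n) → Dec (IsInstruction f)
    isInstruction? f = Fin.all? λ i → Fin.all? λ j →
      ¬? (trivial? f i) →-dec (¬? (trivial? f j) →-dec (i Fin.≟ j))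

    isInstruction-resp : ∀ {f g : Transformation (Fin q) n} → f ≗ g → IsInstruction f → IsInstruction g
    isInstruction-resp {f} {g} f≗g f-instr i j ¬ti ¬tj = f-instr i j (¬ti ∘ trivial-resp i) (¬tj ∘ trivial-resp j)
      where
      trivial-resp : ∀ i → Trivial f i → Trivial g i
      trivial-resp i t x = trans (cong (λ y → lookup y i) (sym (f≗g x))) (t x)

  -- Up to pointwise equality there are only `M ^ M` transformations, so the first instruction and
  -- the map computed by the remaining program can be searched for among the tables.
  computable? : ∀ L (f : Transformation (Fin q) n) → Dec (ComputableInLength f L)
  computable? zero    f = map′ (λ id≗f → [] , id≗f) (λ { ([] , id≗f) → id≗f }) (id ≗? f)
  computable? (suc L) f = map′ build split
    (Fin.any? λ s → Fin.any? λ t → isInstruction? (table s) ×-dec computable? L (table t) ×-dec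
                                   ((table t ∘ table s) ≗? f))
    where
    Step : Fin (M ^ M) → Fin (M ^ M) → Set
    Step s t = IsInstruction (table s) × ComputableInLength (table t) L × (table t ∘ table s) ≗ f
    build : ∃[ s ] ∃[ t ] Step s t → ComputableInLength f (suc L)
    build (s , t , instr , (p , p≗) , eq) = (table s , instr) ∷ p , λ x → trans (p≗ (table s x)) (eq x)
    split : ComputableInLength f (suc L) → ∃[ s ] ∃[ t ] Step s t
    split ((g , instr) ∷ p , eq) = index g , index ⟦ p ⟧ ,
      isInstruction-resp (λ x → sym (table-index g x)) instr ,
      (p , λ x → sym (table-index ⟦ p ⟧ x)) ,
      λ x → trans (table-index ⟦ p ⟧ _) (trans (cong ⟦ p ⟧ (table-index g x)) (eq x))

-- Joining two networks

triangular-id : ∀ {q} n → Triangular {q} {n} id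
triangular-id zero    = _
triangular-id (suc n) = id , triangular-id n , λ _ → refl

length-benes : ∀ m → length (benes m) ≡ suc (m + m)
length-benes zero    = refl
length-benes (suc m) = cong suc (begin
  length (List.map suc (benes m) ++ zero ∷ [])    ≡⟨ length-++ (List.map suc (benes m)) ⟩
  length (List.map suc (benes m)) + 1             ≡⟨ cong (_+ 1) (trans (length-map suc (benes m)) (length-benes m)) ⟩
  suc (m + m) + 1                                 ≡⟨ rearrange m ⟩
  suc m + suc m                                   ∎)
  where
  open ≡-Reasoning
  rearrange : ∀ m → suc (m + m) + 1 ≡ suc m + suc m
  rearrange = solve-∀

computable-4n∸3 : ∀ {q} ⦃ _ : NonZero q ⦄ m (f : Transformation (Fin q) (suc (suc m))) →
                  ComputableInLength f (4 * suc (suc m) ∸ 3)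
computable-4n∸3 {q} m f = route (triangularize (suc (suc m)) f)
  where
  inner : List (Fin (suc (suc m)))
  inner = List.map suc (benes m)
  word : List (Fin (suc (suc m)))
  -- The first network appears without its final `zero`, which is fused with the initial `zero` of
  -- the second: `2n − 2` plus `2n − 1` instructions.
  word = (zero ∷ inner) ++ benes (suc m)
  length-word : length word ≡ 4 * suc (suc m) ∸ 3
  length-word = begin
    suc (length (inner ++ benes (suc m)))        ≡⟨ cong suc (length-++ inner) ⟩
    suc (length inner + length (benes (suc m)))  ≡⟨ cong₂ (λ a b → suc (a + b))
                                                      (trans (length-map suc (benes m)) (length-benes m))
                                                      (length-benes (suc m)) ⟩
    suc (suc (m + m) + suc (suc m + suc m))      ≡⟨ rearrange m ⟩
    5 + 4 * m                                    ≡⟨ cong (_∸ 3) (expand m) ⟨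
    4 * suc (suc m) ∸ 3                          ∎
    where
    open ≡-Reasoning
    rearrange : ∀ m → suc (suc (m + m) + suc (suc m + suc m)) ≡ 5 + 4 * m
    rearrange = solve-∀
    expand : ∀ m → 4 * suc (suc m) ≡ 8 + 4 * m
    expand = solve-∀
  route : ∃[ τ ] ∃[ e ] ∃[ π ] Inj τ × Triangular {q} e × Inj π × f ≗ τ ∘ e ∘ π →
          ComputableInLength f (4 * suc (suc m) ∸ 3)
  route (τ , e , π , τ-inj , tri , π-inj , f≗) = subst (ComputableInLength f) length-word
    (follows⇒computable word (follows-resp word f≗
      (follows-merge (zero ∷ inner)
        (benes-routing (suc m) π id π-inj (triangular-id (suc (suc m))))
        (benes-routing (suc m) τ e τ-inj tri))))

theorem3 : ∀ {a} (A : Set a) (q : ℕ) → A ↔ Fin q → 2 ≤ q →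
    ∀ (n : ℕ) → 2 ≤ n →
    ∀ (f : Transformation A n) →
    ∃[ L ] (IsProceduralComplexity f L × L ≤ 4 * n ∸ 3)
theorem3 A q@(suc _) A↔q 2≤q n@(suc (suc m)) (s≤s (s≤s z≤n)) f =
  -- The minimum is found over `Fin q`, where computability in a given length is decidable.
  -- Conjugation preserves lengths in both directions, so the same `L` is minimal for `f`.
  pull-back (least (λ L → computable? q n L (conj f)) (4 * n ∸ 3) (computable-4n∸3 m (conj f)))
  where
  open Conjugate A↔q
  module Back = Conjugate (↔-sym A↔q)
  back : ∀ {L} → ComputableInLength (conj f) L → ComputableInLength f L
  back c = computable-resp (λ x → trans (map-from-to (f _)) (cong f (map-from-to x)))
                           (Back.conj-computable {f = conj f} c)
  pull-back : ∀ {b} → ∃[ L ] ComputableInLength (conj f) L ×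
                             (∀ L′ → ComputableInLength (conj f) L′ → L ≤ L′) × L ≤ b →
              ∃[ L ] (IsProceduralComplexity f L × L ≤ b)
  pull-back (L , short , minimal , L≤b) =
    L , (back short , λ L′ c → minimal L′ (conj-computable {f = f} c)) , L≤b
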